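{- Let $\tau$ be a first-order transduction. There exist a constant $c$ and a function $f:\mathbb N\to\mathbb N$ such that for every graph $G$, every linear order $\sigma$ on the vertices of $G$, and every $D\in\tau(G)$, there exists a lacon-decomposition $(L,\pi)$ of $D$ with $\mathrm{col}_r(L,\pi)\le f(\mathrm{col}_c(G,\sigma))\cdot\mathrm{col}_{cr}(G,\sigma)$ and $\mathrm{wcol}_r(L,\pi)\le f(\mathrm{col}_c(G,\sigma))\cdot\mathrm{wcol}_{cr}(G,\sigma)$ for all $r$.
   Context: A linear order on vertices is an injective map $\pi:V\to\mathbb N$. For a graph and order $\pi$: $u$ is $r$-reachable from $v$ if $\pi(u)\le\pi(v)$ and there is a path of length at most $r$ from $v$ to $u$ all of whose vertices $w$ satisfy $w=u$ or $\pi(w)\ge\pi(v)$; $u$ is weakly $r$-reachable from $v$ if there is a path of length at most $r$ from $v$ to $u$ with $\pi(u)\le\pi(w)$ for all $w$ on the path. $\mathrm{col}_r(G,\pi)$ (resp. $\mathrm{wcol}_r(G,\pi)$) is the maximum over $v$ of the number of vertices $r$-reachable (resp. weakly $r$-reachable) from $v$. Lacon-decomposition: a pair $(L,\pi)$ where $L$ is a bipartite graph with sides $T$ (target vertices) and $H$ (hidden vertices), each hidden vertex is labeled "0" or "1", $\pi$ is a linear order on $V(L)$ with $\pi(h)<\pi(t)$ for all $h\in H,t\in T$, and for all $t,t'\in T$ we have $N(t)\cap N(t')\neq\emptyset$; the $\pi$-largest vertex of $N(t)\cap N(t')$ is the dominant vertex of $t,t'$. It is a lacon-decomposition of a graph $D$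 if $V(D)=T$ and for all $t\ne t'\in T$, $tt'\in E(D)$ iff the dominant vertex of $t,t'$ is labeled "1". First-order transductions: a basic transduction is a triple $\tau_0=(\chi,\nu,\varphi)$ of first-order formulas with $0,1,2$ free variables; $\tau_0(G)$ is undefined if $G\not\models\chi$, otherwise it is the graph with vertex set $\{v: G\models\nu(v)\}$ and edges $uv$ ($u\neq v$) with $G\models\varphi(u,v)\lor\varphi(v,u)$. A $p$-parameter expansion maps $G$ to the set of all graphs obtained by adding $p$ unary predicates to $G$. An $m$-copy operation maps $G$ to the graph with vertex set $V(G)\times\{1,\dots,m\}$, edges $(v,i)(w,i)$ for $vw\in E(G)$, a binary relation $\sim$ with $(u,i)\sim(v,j)$ iff $u=v$, and unary predicates $Q_i=V(G)\times\{i\}$. A transduction is $\tau=\tau_0\circ\gamma\circ\varepsilon$ with $\varepsilon$ a parameter expansion, $\gamma$ a copy operation, $\tau_0$ a basic transduction; $\tau(G)$ is thus a set of graphs. -}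

module Defs where

open import Data.Nat using (ℕ; zero; suc; _+_; _*_; _≤_; _<_; _⊔_; _≤ᵇ_)
open import Data.Bool using (Bool; true; false; _∧_; _∨_; not; if_then_else_)
open import Data.Fin using (Fin; _↑ˡ_; _↑ʳ_; splitAt)
open import Data.Fin.Properties using () renaming (_≟_ to _≟F_)
open import Data.List using (List; []; _∷_; map; concatMap; upTo; allFin; foldr; cartesianProduct)
open import Data.Nat.ListAction using (sum)
open import Data.Bool.ListAction using (any; all)
open import Data.Product using (Σ; _×_; _,_; proj₁; proj₂; ∃)
open import Data.Sum using (_⊎_; inj₁; inj₂)
open import Relation.Nullary.Decidable using (⌊_⌋)
open import Relation.Binary.PropositionalEquality using (_≡_; _≢_; refl)
open import Function.Definitions using (Injective)

record Graph : Set where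
  field
    size  : ℕ
    adj   : Fin size → Fin size → Bool
    sym   : ∀ a b → adj a b ≡ adj b a
    irrefl : ∀ a → adj a a ≡ false
open Graph public

_==_ : ∀ {n} → Fin n → Fin n → Bool
x == y = ⌊ x ≟F y ⌋

IsLinearOrder : ∀ {n} → (Fin n → ℕ) → Set
IsLinearOrder π = Injective _≡_ _≡_ π

module _ (G : Graph) where
  walks : ℕ → Fin (size G) → List (List (Fin (size G)))
  walks zero    v = (v ∷ []) ∷ []
  walks (suc k) v =
    concatMap (λ w → if adj G v w then map (v ∷_) (walks k w) else [])
              (allFin (size G))

  walksUpTo : ℕ → Fin (size G) → List (List (Fin (size G)))
  walksUpTo r v = concatMap (λ k → walks k v) (upTo (suc r))

endsAt : ∀ {n} → Fin n → List (Fin n) → Bool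
endsAt u []           = false
endsAt u (x ∷ [])     = x == u
endsAt u (x ∷ y ∷ ys) = endsAt u (y ∷ ys)

distinct : ∀ {n} → List (Fin n) → Bool
distinct []       = true
distinct (x ∷ xs) = not (any (x ==_) xs) ∧ distinct xs

module _ (G : Graph) (π : Fin (size G) → ℕ) where
  reach : ℕ → Fin (size G) → Fin (size G) → Bool
  reach r v u =
    (π u ≤ᵇ π v) ∧
    any (λ P → endsAt u P ∧ distinct P ∧ all (λ w → (w == u) ∨ (π v ≤ᵇ π w)) P)
        (walksUpTo G r v)

  wreach : ℕ → Fin (size G) → Fin (size G) → Bool
  wreach r v u =
    any (λ P → endsAt u P ∧ distinct P ∧ all (λ w → π u ≤ᵇ π w) P)
        (walksUpTo G r v)

count : ∀ {n} → (Fin n → Bool) → ℕ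
count {n} p = sum (map (λ u → if p u then 1 else 0) (allFin n))

maxOver : ∀ {n} → (Fin n → ℕ) → ℕ
maxOver {n} f = foldr _⊔_ 0 (map f (allFin n))

col : ℕ → (G : Graph) → (Fin (size G) → ℕ) → ℕ
col r G π = maxOver (λ v → count (reach G π r v))

wcol : ℕ → (G : Graph) → (Fin (size G) → ℕ) → ℕ
wcol r G π = maxOver (λ v → count (wreach G π r v))

data Formula (U : Set) : ℕ → Set where
  eqᶠ  : ∀ {m} → Fin m → Fin m → Formula U m
  edgeᶠ : ∀ {m} → Fin m → Fin m → Formula U m
  simᶠ : ∀ {m} → Fin m → Fin m → Formula U m
  unᶠ  : ∀ {m} → U → Fin m → Formula U m
  ¬ᶠ   : ∀ {m} → Formula U m → Formula U m
  _∨ᶠ_ : ∀ {m} → Formula U m → Formula U m → Formula U m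
  ∃ᶠ   : ∀ {m} → Formula U (suc m) → Formula U m

record Structure (U : Set) : Set₁ where
  field
    Elem  : Set
    elems : List Elem
    _≐_   : Elem → Elem → Bool
    E     : Elem → Elem → Bool
    Sim   : Elem → Elem → Bool
    Un    : U → Elem → Bool

extend : ∀ {A : Set} {m} → A → (Fin m → A) → Fin (suc m) → A
extend a ρ Fin.zero    = a
extend a ρ (Fin.suc i) = ρ i

⟦_⟧ : ∀ {U m} → Formula U m → (S : Structure U) → (Fin m → Structure.Elem S) → Bool
⟦ eqᶠ i j ⟧   S ρ = Structure._≐_ S (ρ i) (ρ j)
⟦ edgeᶠ i j ⟧ S ρ = Structure.E S (ρ i) (ρ j)
⟦ simᶠ i j ⟧  S ρ = Structure.Sim S (ρ i) (ρ j)
⟦ unᶠ a i ⟧   S ρ = Structure.Un S a (ρ i)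
⟦ ¬ᶠ φ ⟧      S ρ = not (⟦ φ ⟧ S ρ)
⟦ φ ∨ᶠ ψ ⟧    S ρ = ⟦ φ ⟧ S ρ ∨ ⟦ ψ ⟧ S ρ
⟦ ∃ᶠ φ ⟧      S ρ = any (λ a → ⟦ φ ⟧ S (extend a ρ)) (Structure.elems S)

-- Transductions: τ = τ₀ ∘ γ ∘ ε with ε a p-parameter expansion,
-- γ an m-copy operation, τ₀ = (χ, ν, φ) a basic transduction.
-- The formulas may use E, ~, the p parameter predicates (inj₁) and the
-- m copy predicates Q_i (inj₂).

record Transduction : Set where
  field
    p m : ℕ
    χ : Formula (Fin p ⊎ Fin m) 0
    ν : Formula (Fin p ⊎ Fin m) 1
    φ : Formula (Fin p ⊎ Fin m) 2
open Transduction public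

copyExpansion : (G : Graph) (p m : ℕ) → (Fin p → Fin (size G) → Bool)
              → Structure (Fin p ⊎ Fin m)
copyExpansion G p m P = record
  { Elem  = Fin (size G) × Fin m
  ; elems = cartesianProduct (allFin (size G)) (allFin m)
  ; _≐_   = λ { (v , i) (w , j) → (v == w) ∧ (i == j) }
  ; E     = λ { (v , i) (w , j) → (i == j) ∧ adj G v w }
  ; Sim   = λ { (v , i) (w , j) → v == w }
  ; Un    = λ { (inj₁ a) (v , i) → P a v ; (inj₂ k) (v , i) → k == i }
  }

env1 : ∀ {A : Set} → A → Fin 1 → A
env1 a _ = a

env2 : ∀ {A : Set} → A → A → Fin 2 → A
env2 a b Fin.zero    = a
env2 a b (Fin.suc _) = b

record _∈⟦_⟧_ (D : Graph) (τ : Transduction) (G : Graph) : Set where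
  field
    params : Fin (p τ) → Fin (size G) → Bool
  S : Structure (Fin (p τ) ⊎ Fin (m τ))
  S = copyExpansion G (p τ) (m τ) params
  field
    χ-holds : ⟦ χ τ ⟧ S (λ ()) ≡ true
    f       : Fin (size D) → Fin (size G) × Fin (m τ)
    f-inj   : Injective _≡_ _≡_ f
    f-in    : ∀ a → ⟦ ν τ ⟧ S (env1 (f a)) ≡ true
    f-onto  : ∀ x → ⟦ ν τ ⟧ S (env1 x) ≡ true → ∃ λ a → f a ≡ x
    f-edges : ∀ a b → a ≢ b →
              adj D a b ≡ (⟦ φ τ ⟧ S (env2 (f a) (f b)) ∨ ⟦ φ τ ⟧ S (env2 (f b) (f a)))

-- Lacon-decompositions
-- L is the bipartite graph with vertex set T ⊎ H encoded as
-- Fin (t + h): targets are  i ↑ˡ h  (i : Fin t), hidden vertices are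
-- t ↑ʳ x  (x : Fin h).  Its edges are given by N : T → H → Bool.

bipAdj : ∀ {t h} → (Fin t → Fin h → Bool) → Fin t ⊎ Fin h → Fin t ⊎ Fin h → Bool
bipAdj N (inj₁ a) (inj₁ b) = false
bipAdj N (inj₁ a) (inj₂ y) = N a y
bipAdj N (inj₂ x) (inj₁ b) = N b x
bipAdj N (inj₂ x) (inj₂ y) = false

bipAdj-sym : ∀ {t h} (N : Fin t → Fin h → Bool) a b → bipAdj N a b ≡ bipAdj N b a
bipAdj-sym N (inj₁ a) (inj₁ b) = refl
bipAdj-sym N (inj₁ a) (inj₂ y) = refl
bipAdj-sym N (inj₂ x) (inj₁ b) = refl
bipAdj-sym N (inj₂ x) (inj₂ y) = refl

bipAdj-irrefl : ∀ {t h} (N : Fin t → Fin h → Bool) a → bipAdj N a a ≡ false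
bipAdj-irrefl N (inj₁ a) = refl
bipAdj-irrefl N (inj₂ x) = refl

bipartite : (t h : ℕ) → (Fin t → Fin h → Bool) → Graph
bipartite t h N = record
  { size   = t + h
  ; adj    = λ a b → bipAdj N (splitAt t a) (splitAt t b)
  ; sym    = λ a b → bipAdj-sym N (splitAt t a) (splitAt t b)
  ; irrefl = λ a → bipAdj-irrefl N (splitAt t a)
  }

record LaconDecomposition (D : Graph) : Set where
  field
    h     : ℕ
    N     : Fin (size D) → Fin h → Bool
    label : Fin h → Bool                       -- true = "1", false = "0"
    π     : Fin (size D + h) → ℕ
    π-inj : Injective _≡_ _≡_ π
    hidden-first : ∀ (t : Fin (size D)) (x : Fin h) → π (size D ↑ʳ x) < π (t ↑ˡ h)
    common : ∀ (t t' : Fin (size D)) → ∃ λ x → N t x ≡ true × N t' x ≡ true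

  L : Graph
  L = bipartite (size D) h N

  Dominant : Fin (size D) → Fin (size D) → Fin h → Set
  Dominant t t' x = N t x ≡ true × N t' x ≡ true ×
    (∀ y → N t y ≡ true → N t' y ≡ true → π (size D ↑ʳ y) ≤ π (size D ↑ʳ x))

  field
    represents : ∀ (t t' : Fin (size D)) → t ≢ t' →
      (adj D t t' ≡ true → ∃ λ x → Dominant t t' x × label x ≡ true) ×
      ((∃ λ x → Dominant t t' x × label x ≡ true) → adj D t t' ≡ true)
open LaconDecomposition public

module Submission where

-- Let W(u) be the set of vertices weakly s-reachable from u.  The hidden vertices are triples of a
-- place, which is a vertex w of G or a bottom place, and two types; a target at the vertex u is joined
-- to those hidden vertices at w ∈ W(u) (or at the bottom) that mention its type over w.  If w is the
-- largest common element of W(u) and W(v), then every path of length at most s between u and v meets,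
-- at its minimum, an element of W(u) ∩ W(v), and all these elements belong to the set R of vertices
-- weakly 2s-reachable from w, whose size is bounded in terms of col.  So u and v are far apart once R
-- is isolated, and it remains to see that the truth of φ(u , v) on far apart vertices depends only on
-- finitely many local types.
--
-- This is Gaifman locality inside a single coloured graph, which allows the colouring to be
-- adapted to the graph: for every local type, fix a maximal scattered set of vertices of that type
-- (truncated to k + 1 elements) and let the colours record which of its elements are close.
--
-- For the bounds, a walk in the decomposition projects to a walk in G, and W(x) is covered by
-- iterating strong reachability from x.

open import Defs
open import Data.Nat using (ℕ; zero; suc; _+_; _*_; _^_; _≤_; _<_; _⊔_; _≤ᵇ_; z≤n; s≤s; s≤s⁻¹)
open import Data.Nat.Properties
  using (≤-refl; ≤-trans; ≤-reflexive; ≤-antisym; <-irrefl; <-≤-trans; <⇒≱; ≮⇒≥; ≰⇒≥; _≤?_; <-cmp;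
         ≤ᵇ⇒≤; ≤⇒≤ᵇ; suc-injective; n≤1+n; m≤m+n; m≤n+m; m≤m*n; +-comm; +-cancelˡ-≡; +-cancelˡ-≤;
         +-mono-≤; +-monoʳ-<; *-comm; *-assoc; *-distribʳ-+; *-mono-≤; *-monoˡ-≤;
         m≤m⊔n; m≤n⊔m; ⊔-lub; m⊔n≤o⇒m≤o; m⊔n≤o⇒n≤o; module ≤-Reasoning)
open import Data.Bool using (Bool; true; false; _∧_; _∨_; not; T; if_then_else_)
open import Data.Fin using (Fin; zero; suc; combine; remQuot; splitAt; _↑ˡ_; _↑ʳ_; funToFin; finToFun; toℕ)
open import Data.Fin.Properties
  using (any?; all?; pigeonhole; injective⇒≤; toℕ-injective; combine-injective;
         combine-injectiveˡ; combine-injectiveʳ; finToFun-funToFin; remQuot-combine; combine-remQuot;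
         splitAt-↑ˡ; splitAt-↑ʳ; splitAt⁻¹-↑ˡ; splitAt⁻¹-↑ʳ; toℕ<n; toℕ-↑ˡ; toℕ-↑ʳ)
  renaming (_≟_ to _≟F_)
import Data.Bool.Properties as Bool
open import Data.List using (List; []; _∷_; length)
import Data.List as List
open import Data.Bool.ListAction using (any; all)
open import Data.List.Relation.Unary.All using (All; []; _∷_)
import Data.List.Relation.Unary.All as All
open import Data.List.Relation.Unary.All.Properties using (¬Any⇒All¬; all⁺; all⁻)
open import Data.List.Relation.Unary.Any using (Any; here; there)
import Data.List.Relation.Unary.Any as Any
open import Data.List.Relation.Unary.Any.Properties using (lookup-index; any⁺; any⁻)
open import Data.List.Membership.Propositional using (_∈_; find; lose)
open import Data.List.Membership.Propositional.Properties
  using (∈-lookup; ∈-cartesianProduct⁺; ∈-allFin; ∈-concatMap⁺; ∈-concatMap⁻; ∈-++⁺ˡ; ∈-++⁺ʳ;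
         ∈-map⁺; ∈-map⁻; ∈-upTo⁺; ∈-upTo⁻; ∈-filter⁺; ∈-filter⁻)
open import Data.List.Relation.Unary.Unique.Propositional using (Unique)
import Data.List.Relation.Unary.Unique.Propositional.Properties as Unique
open import Data.List.Relation.Unary.AllPairs using (AllPairs; []; _∷_)
open import Data.Vec using (Vec; []; _∷_; lookup)
open import Data.Product using (Σ; _×_; _,_; proj₁; proj₂; ∃; ∃₂)
import Data.Sum as Sum
open import Data.Sum using (_⊎_; inj₁; inj₂; [_,_]′)
open import Data.Empty using (⊥; ⊥-elim)
open import Data.Unit using (⊤; tt)
open import Data.List.Properties using (length-++; length-map; length-tabulate)
open import Data.Nat.ListAction using (sum)
open import Function using (_∘_)
open import Function.Bundles using (Equivalence)
open import Relation.Nullary using (¬_; Dec; yes; no)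
open import Relation.Nullary.Decidable using (⌊_⌋; _×-dec_; _⊎-dec_; _→-dec_; ¬?; map′; toWitness; fromWitness)
open import Relation.Binary.Definitions using (tri<; tri≈; tri>)
open import Relation.Binary.PropositionalEquality as ≡
  using (_≡_; _≢_; refl; cong; cong₂; subst; subst₂; trans)

-- Local types

-- The index only bounds the length, because `stay` is available at every index. Conditions are put
-- on edges, so a trivial walk carries none.
data Walk {V : Set} (E : V → V → Set) : ℕ → V → V → Set where
  stay : ∀ {r x} → Walk E r x x
  step : ∀ {r x y z} → E x y → Walk E r y z → Walk E (suc r) x z

module Walks {V : Set} where

  weaken : ∀ {E F : V → V → Set} {r s x y} →
           (∀ {a b} → E a b → F a b) → r ≤ s → Walk E r x y → Walk F s x y
  weaken E⇒F r≤s       stay       = stay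
  weaken E⇒F (s≤s r≤s) (step e w) = step (E⇒F e) (weaken E⇒F r≤s w)

  lengthen : ∀ {E : V → V → Set} {r s x y} → r ≤ s → Walk E r x y → Walk E s x y
  lengthen = weaken (λ e → e)

  infixr 5 _++ʷ_
  _++ʷ_ : ∀ {E : V → V → Set} {r s x y z} → Walk E r x y → Walk E s y z → Walk E (r + s) x z
  stay {r}   ++ʷ w = lengthen (m≤n+m _ r) w
  step e w ++ʷ w′ = step e (w ++ʷ w′)

  snoc : ∀ {E : V → V → Set} {r x y z} → Walk E r x y → E y z → Walk E (suc r) x z
  snoc stay        e′ = step e′ stay
  snoc (step e w) e′ = step e (snoc w e′)

  reverse : ∀ {E : V → V → Set} {r x y} → (∀ {a b} → E a b → E b a) → Walk E r x y → Walk E r y x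
  reverse E-sym stay       = stay
  reverse E-sym (step e w) = snoc (reverse E-sym w) (E-sym e)

open Walks

walk? : ∀ {n} {E : Fin n → Fin n → Set} → (∀ x y → Dec (E x y)) → ∀ r x y → Dec (Walk E r x y)
walk? E? zero    x y = map′ (λ { refl → stay }) (λ { stay → refl }) (x ≟F y)
walk? E? (suc r) x y =
  map′ (λ { (inj₁ refl) → stay ; (inj₂ (z , e , w)) → step e w })
       (λ { stay → inj₁ refl ; (step e w) → inj₂ (_ , e , w) })
       ((x ≟F y) ⊎-dec any? (λ z → E? x z ×-dec walk? E? r z y))

bit : Bool → Fin 2
bit false = zero
bit true  = suc zero

bit-injective : ∀ {a b} → bit a ≡ bit b → a ≡ b
bit-injective {false} {false} _ = refl
bit-injective {true}  {true}  _ = refl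

funToFin-injective : ∀ {m n} {f g : Fin m → Fin n} → funToFin f ≡ funToFin g → ∀ i → f i ≡ g i
funToFin-injective {f = f} {g} eq i =
  trans (≡.sym (finToFun-funToFin f i)) (trans (cong (λ k → finToFun k i) eq) (finToFun-funToFin g i))

dec-eq⇒ : ∀ {A B : Set} {a? : Dec A} {b? : Dec B} → ⌊ a? ⌋ ≡ ⌊ b? ⌋ → A → B
dec-eq⇒ {a? = yes _} {yes b} _ _ = b
dec-eq⇒ {a? = no ¬a} _ a = ⊥-elim (¬a a)

dec-false : ∀ {A : Set} (a? : Dec A) → ¬ A → ⌊ a? ⌋ ≡ false
dec-false (yes a) ¬a = ⊥-elim (¬a a)
dec-false (no _)  _  = refl

-- Reads the list as a Fin M-indexed family padded with false.
at : ∀ {V : Set} {M} → (V → Bool) → List V → Fin M → Bool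
at p []       j       = false
at p (c ∷ cs) zero    = p c
at p (c ∷ cs) (suc j) = at p cs j

at-lookup : ∀ {V : Set} {M} (cs : List V) → length cs ≤ M → (i : Fin (length cs)) →
            Σ (Fin M) λ j → ∀ p → at p cs j ≡ p (List.lookup cs i)
at-lookup (c ∷ cs) (s≤s le) zero    = zero , λ p → refl
at-lookup (c ∷ cs) (s≤s le) (suc i) with at-lookup cs le i
... | j , eq = suc j , eq

allPairs-lookup : ∀ {A : Set} {R : A → A → Set} {xs} → AllPairs R xs → ∀ {i j} → toℕ i < toℕ j →
                  R (List.lookup xs i) (List.lookup xs j)
allPairs-lookup (r ∷ rs) {zero}  {suc j} i<j = All.lookup r (∈-lookup j)
allPairs-lookup (r ∷ rs) {suc i} {suc j} i<j = allPairs-lookup rs (s≤s⁻¹ i<j)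

-- An interleaving rather than a concatenation: types grow by prepending a vertex, and the new
-- vertex may belong to either of the two tuples.
data Mix : ℕ → ℕ → ℕ → Set where
  done  : Mix 0 0 0
  left  : ∀ {a b k} → Mix a b k → Mix (suc a) b (suc k)
  right : ∀ {a b k} → Mix a b k → Mix a (suc b) (suc k)

mix : ∀ {V : Set} {a b k} → Mix a b k → Vec V a → Vec V b → Vec V k
mix done      []       []       = []
mix (left s)  (x ∷ xs) ys       = x ∷ mix s xs ys
mix (right s) xs       (y ∷ ys) = y ∷ mix s xs ys

origin : ∀ {a b k} → Mix a b k → Fin k → Fin a ⊎ Fin b
origin (left s)  zero    = inj₁ zero
origin (left s)  (suc i) = [ inj₁ ∘ suc , inj₂ ]′ (origin s i)
origin (right s) zero    = inj₂ zero
origin (right s) (suc i) = [ inj₁ , inj₂ ∘ suc ]′ (origin s i)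

lookup-mix : ∀ {V : Set} {a b k} (s : Mix a b k) (xs : Vec V a) (ys : Vec V b) i →
             lookup (mix s xs ys) i ≡ [ lookup xs , lookup ys ]′ (origin s i)
lookup-mix (left s)  (x ∷ xs) ys       zero    = refl
lookup-mix (left s)  (x ∷ xs) ys       (suc i) with origin s i | lookup-mix s xs ys i
... | inj₁ _ | eq = eq
... | inj₂ _ | eq = eq
lookup-mix (right s) xs       (y ∷ ys) zero    = refl
lookup-mix (right s) xs       (y ∷ ys) (suc i) with origin s i | lookup-mix s xs ys i
... | inj₁ _ | eq = eq
... | inj₂ _ | eq = eq

inˡ : ∀ {V : Set} {a b k} (s : Mix a b k) (xs : Vec V a) (ys : Vec V b) i →
      ∃ λ j → lookup (mix s xs ys) j ≡ lookup xs i
inˡ (left s)  (x ∷ xs) ys       zero    = zero , refl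
inˡ (left s)  (x ∷ xs) ys       (suc i) with inˡ s xs ys i
... | j , eq = suc j , eq
inˡ (right s) xs       (y ∷ ys) i       with inˡ s xs ys i
... | j , eq = suc j , eq

inʳ : ∀ {V : Set} {a b k} (s : Mix a b k) (xs : Vec V a) (ys : Vec V b) i →
      ∃ λ j → lookup (mix s xs ys) j ≡ lookup ys i
inʳ (left s)  (x ∷ xs) ys       i       with inʳ s xs ys i
... | j , eq = suc j , eq
inʳ (right s) xs       (y ∷ ys) zero    = zero , refl
inʳ (right s) xs       (y ∷ ys) (suc i) with inʳ s xs ys i
... | j , eq = suc j , eq

rights : ∀ k → Mix 0 k k
rights zero    = done
rights (suc k) = right (rights k)

mix-rights : ∀ {V : Set} {k} (ys : Vec V k) → mix (rights k) [] ys ≡ ys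
mix-rights []       = refl
mix-rights (y ∷ ys) = cong (y ∷_) (mix-rights ys)

-- The number of values of `code`: colours and a matrix of links at the bottom, then for each radius
-- a set of codes of tuples with one more entry.
types : ℕ → List ℕ → ℕ → ℕ
types N []       k = N ^ k * ((4 ^ k) ^ k)
types N (r ∷ rs) k = types N rs k * 2 ^ types N rs (suc k)

-- Two tuples whose distance exceeds the span of rs cannot interact in the types of radii rs.
span : List ℕ → ℕ
span []       = 1
span (r ∷ rs) = r + span rs

-- Three spans: two from a vertex to a centre that covers it and one from that centre to the tuple,
-- as needed in `respond`.
radii : ℕ → List ℕ
radii zero    = []
radii (suc q) = (span (radii q) + span (radii q) + span (radii q)) ∷ radii q

-- Each level of `refine` adds one bit for every type and each of its at most `suc k` centres.
colours : ℕ → ℕ → ℕ → ℕ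
colours zero    k N = N
colours (suc q) k N =
  colours q (suc k) N * (2 ^ suc k) ^ types (colours q (suc k) N) (radii q) 1

module Local {n : ℕ} (e : Fin n → Fin n → Bool) (e-sym : ∀ x y → e x y ≡ e y x) where

  V : Set
  V = Fin n

  Edge : V → V → Set
  Edge x y = e x y ≡ true

  Within : ℕ → V → V → Set
  Within = Walk Edge

  within? : ∀ r x y → Dec (Within r x y)
  within? = walk? (λ x y → e x y Bool.≟ true)

  within-sym : ∀ {r x y} → Within r x y → Within r y x
  within-sym = reverse (λ {x} {y} → trans (e-sym y x))

  Near : ∀ {k} → ℕ → V → Vec V k → Set
  Near r x ys = ∃ λ i → Within r x (lookup ys i)

  near? : ∀ {k} r x (ys : Vec V k) → Dec (Near r x ys)
  near? r x ys = any? (λ i → within? r x (lookup ys i))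

  Apart : ∀ {a b} → ℕ → Vec V a → Vec V b → Set
  Apart d xs ys = ∀ i j → ¬ Within d (lookup xs i) (lookup ys j)

  link : V → V → Fin 4
  link x y = combine (bit (x == y)) (bit (e x y))

  link⇒== : ∀ {x y x′ y′} → link x y ≡ link x′ y′ → (x == y) ≡ (x′ == y′)
  link⇒== {x} {y} {x′} {y′} eq =
    bit-injective (combine-injectiveˡ (bit (x == y)) (bit (e x y)) (bit (x′ == y′)) (bit (e x′ y′)) eq)

  link⇒e : ∀ {x y x′ y′} → link x y ≡ link x′ y′ → e x y ≡ e x′ y′
  link⇒e {x} {y} {x′} {y′} eq =
    bit-injective (combine-injectiveʳ (bit (x == y)) (bit (e x y)) (bit (x′ == y′)) (bit (e x′ y′)) eq)

  unlinked : ∀ {x y} → ¬ Within 1 x y → link x y ≡ zero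
  unlinked {x} {y} far = cong₂ (λ a b → combine (bit a) (bit b))
    (dec-false (x ≟F y) λ { refl → far stay })
    (Bool.¬-not λ exy → far (step exy stay))

  Atomic : ∀ {k N} → (V → Fin N) → Vec V k → Vec V k → Set
  Atomic κ xs ys = (∀ i → κ (lookup xs i) ≡ κ (lookup ys i))
                 × (∀ i j → link (lookup xs i) (lookup xs j) ≡ link (lookup ys i) (lookup ys j))

  -- A back-and-forth game with one move per radius, in which only vertices within that radius of
  -- the tuple may be played.
  Similar : ∀ {k N} → (V → Fin N) → List ℕ → Vec V k → Vec V k → Set
  Similar κ []       xs ys = Atomic κ xs ys
  Similar κ (r ∷ rs) xs ys = Similar κ rs xs ys
    × (∀ a → Near r a xs → ∃ λ b → Near r b ys × Similar κ rs (a ∷ xs) (b ∷ ys))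
    × (∀ b → Near r b ys → ∃ λ a → Near r a xs × Similar κ rs (b ∷ ys) (a ∷ xs))

  similar-sym : ∀ {k N} {κ : V → Fin N} rs {xs ys : Vec V k} → Similar κ rs xs ys → Similar κ rs ys xs
  similar-sym []       (c , l)     = (λ i → ≡.sym (c i)) , (λ i j → ≡.sym (l i j))
  similar-sym (r ∷ rs) (s , f , g) = similar-sym rs s , g , f

  similar⇒atomic : ∀ {k N} {κ : V → Fin N} rs {xs ys : Vec V k} → Similar κ rs xs ys → Atomic κ xs ys
  similar⇒atomic []       s       = s
  similar⇒atomic (r ∷ rs) (s , _) = similar⇒atomic rs s

  coarsen : ∀ {k N N′} {κ : V → Fin N} {κ′ : V → Fin N′} rs {xs ys : Vec V k} →
            (∀ {x y} → κ′ x ≡ κ′ y → κ x ≡ κ y) → Similar κ′ rs xs ys → Similar κ rs xs ys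
  coarsen []       κ′⇒κ (c , l)     = (λ i → κ′⇒κ (c i)) , l
  coarsen (r ∷ rs) κ′⇒κ (s , f , g) = coarsen rs κ′⇒κ s
    , (λ a near → let b , near′ , s′ = f a near in b , near′ , coarsen rs κ′⇒κ s′)
    , (λ b near → let a , near′ , s′ = g b near in a , near′ , coarsen rs κ′⇒κ s′)

  -- The set of codes of near extensions is stored as a characteristic function, so the number of
  -- types does not depend on the size of the graph.
  code : ∀ {k N} → (V → Fin N) → (rs : List ℕ) → Vec V k → Fin (types N rs k)
  code κ []       xs = combine (funToFin λ i → κ (lookup xs i))
                               (funToFin λ i → funToFin λ j → link (lookup xs i) (lookup xs j))
  code κ (r ∷ rs) xs = combine (code κ rs xs)
    (funToFin λ c → bit ⌊ any? (λ a → near? r a xs ×-dec (code κ rs (a ∷ xs) ≟F c)) ⌋)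

  code⇒similar : ∀ {k N} {κ : V → Fin N} rs {xs ys : Vec V k} →
                 code κ rs xs ≡ code κ rs ys → Similar κ rs xs ys
  code⇒similar {κ = κ} [] {xs} {ys} eq
    with combine-injective (funToFin λ i → κ (lookup xs i)) _ (funToFin λ i → κ (lookup ys i)) _ eq
  ... | eq₁ , eq₂ = funToFin-injective eq₁ , λ i → funToFin-injective (funToFin-injective eq₂ i)
  code⇒similar {κ = κ} (r ∷ rs) {xs} {ys} eq
    with combine-injective (code κ rs xs) _ (code κ rs ys) _ eq
  ... | eq₁ , eq₂ = code⇒similar rs eq₁ , forth (λ c → bit-injective (bits c))
                                        , forth (λ c → bit-injective (≡.sym (bits c)))
    where
    ext? : (zs : Vec V _) (c : Fin (types _ rs _)) → Dec (∃ λ a → Near r a zs × code κ rs (a ∷ zs) ≡ c)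
    ext? zs c = any? (λ a → near? r a zs ×-dec (code κ rs (a ∷ zs) ≟F c))
    bits : ∀ c → bit ⌊ ext? xs c ⌋ ≡ bit ⌊ ext? ys c ⌋
    bits = funToFin-injective eq₂
    forth : ∀ {xs ys} → (∀ c → ⌊ ext? xs c ⌋ ≡ ⌊ ext? ys c ⌋) →
            ∀ a → Near r a xs → ∃ λ b → Near r b ys × Similar κ rs (a ∷ xs) (b ∷ ys)
    forth {xs} {ys} same a near
      with dec-eq⇒ {a? = ext? xs _} {ext? ys _} (same (code κ rs (a ∷ xs))) (a , near , refl)
    ... | b , near′ , eq = b , near′ , code⇒similar rs (≡.sym eq)

  near-inˡ : ∀ {a b k r x} (s : Mix a b k) {xs : Vec V a} {ys : Vec V b} →
             Near r x xs → Near r x (mix s xs ys)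
  near-inˡ {r = r} {x} s {xs} {ys} (i , w) with inˡ s xs ys i
  ... | j , eq = j , subst (Within r x) (≡.sym eq) w

  near-inʳ : ∀ {a b k r x} (s : Mix a b k) {xs : Vec V a} {ys : Vec V b} →
             Near r x ys → Near r x (mix s xs ys)
  near-inʳ {r = r} {x} s {xs} {ys} (i , w) with inʳ s xs ys i
  ... | j , eq = j , subst (Within r x) (≡.sym eq) w

  near-mix : ∀ {a b k r x} (s : Mix a b k) {xs : Vec V a} {ys : Vec V b} →
             Near r x (mix s xs ys) → Near r x xs ⊎ Near r x ys
  near-mix {r = r} {x} s {xs} {ys} (i , w) with origin s i | lookup-mix s xs ys i
  ... | inj₁ j | eq = inj₁ (j , subst (Within r x) eq w)
  ... | inj₂ j | eq = inj₂ (j , subst (Within r x) eq w)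

  apart-closer : ∀ {a b d d′} (xs : Vec V a) (ys : Vec V b) → d′ ≤ d → Apart d xs ys → Apart d′ xs ys
  apart-closer xs ys d′≤d ap i j w = ap i j (lengthen d′≤d w)

  apart-sym : ∀ {a b d} (xs : Vec V a) (ys : Vec V b) → Apart d xs ys → Apart d ys xs
  apart-sym xs ys ap i j w = ap j i (within-sym w)

  apart-∷ : ∀ {a b r d x} (xs : Vec V a) (ys : Vec V b) →
            Near r x xs → Apart (r + d) xs ys → Apart d (x ∷ xs) ys
  apart-∷         xs ys (i , w) ap zero    j w′ = ap i j (within-sym w ++ʷ w′)
  apart-∷ {r = r} xs ys near    ap (suc i) j w′ = ap i j (lengthen (m≤n+m _ r) w′)

  -- A local form of Feferman-Vaught composition: a vertex near the mixed tuple is near one of its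
  -- parts and is answered there, and the distance between the parts shrinks by at most its radius.
  -- At the bottom, the remaining distance excludes links between the parts.
  compose : ∀ {a b k N} {κ : V → Fin N} rs (s : Mix a b k) {xs xs′ : Vec V a} {ys ys′ : Vec V b} →
            Apart (span rs) xs ys → Apart (span rs) xs′ ys′ →
            Similar κ rs xs xs′ → Similar κ rs ys ys′ → Similar κ rs (mix s xs ys) (mix s xs′ ys′)
  compose {κ = κ} [] s {xs} {xs′} {ys} {ys′} ap ap′ (c , l) (c′ , l′) = colour , links
    where
    colour : ∀ i → κ (lookup (mix s xs ys) i) ≡ κ (lookup (mix s xs′ ys′) i)
    colour i rewrite lookup-mix s xs ys i | lookup-mix s xs′ ys′ i with origin s i
    ... | inj₁ i₁ = c i₁
    ... | inj₂ i₂ = c′ i₂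
    links : ∀ i j → link (lookup (mix s xs ys) i) (lookup (mix s xs ys) j)
                  ≡ link (lookup (mix s xs′ ys′) i) (lookup (mix s xs′ ys′) j)
    links i j rewrite lookup-mix s xs ys i | lookup-mix s xs′ ys′ i
                    | lookup-mix s xs ys j | lookup-mix s xs′ ys′ j with origin s i | origin s j
    ... | inj₁ i₁ | inj₁ j₁ = l i₁ j₁
    ... | inj₁ i₁ | inj₂ j₂ = trans (unlinked (ap i₁ j₂)) (≡.sym (unlinked (ap′ i₁ j₂)))
    ... | inj₂ i₂ | inj₁ j₁ = trans (unlinked (ap j₁ i₂ ∘ within-sym))
                                    (≡.sym (unlinked (ap′ j₁ i₂ ∘ within-sym)))
    ... | inj₂ i₂ | inj₂ j₂ = l′ i₂ j₂
  compose {κ = κ} (r ∷ rs) s {xs} {xs′} {ys} {ys′} ap ap′ sx@(sx₀ , fx , gx) sy@(sy₀ , fy , gy) =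
    compose rs s (apart-closer xs ys (m≤n+m _ r) ap) (apart-closer xs′ ys′ (m≤n+m _ r) ap′) sx₀ sy₀
    , forth ap ap′ sx₀ sy₀ fx fy
    , forth ap′ ap (similar-sym rs sx₀) (similar-sym rs sy₀) gx gy
    where
    forth : ∀ {xs xs′ ys ys′} → Apart (r + span rs) xs ys → Apart (r + span rs) xs′ ys′ →
            Similar κ rs xs xs′ → Similar κ rs ys ys′ →
            (∀ a → Near r a xs → ∃ λ b → Near r b xs′ × Similar κ rs (a ∷ xs) (b ∷ xs′)) →
            (∀ a → Near r a ys → ∃ λ b → Near r b ys′ × Similar κ rs (a ∷ ys) (b ∷ ys′)) →
            ∀ a → Near r a (mix s xs ys) →
            ∃ λ b → Near r b (mix s xs′ ys′) × Similar κ rs (a ∷ mix s xs ys) (b ∷ mix s xs′ ys′)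
    forth {xs} {xs′} {ys} {ys′} ap ap′ sx sy fx fy a near with near-mix s near
    ... | inj₁ nearx = let b , nearx′ , sx′ = fx a nearx in
      b , near-inˡ s nearx′ , compose rs (left s) (apart-∷ xs ys nearx ap) (apart-∷ xs′ ys′ nearx′ ap′) sx′ sy
    ... | inj₂ neary = let b , neary′ , sy′ = fy a neary in
      b , near-inʳ s neary′ , compose rs (right s)
        (apart-sym (a ∷ ys) xs (apart-∷ ys xs neary (apart-sym xs ys ap)))
        (apart-sym (b ∷ ys′) xs′ (apart-∷ ys′ xs′ neary′ (apart-sym xs′ ys′ ap′))) sx sy′

  -- Scattered sets, refined colours and Gaifman locality

  module _ {P : V → Set} (P? : ∀ x → Dec (P x)) (d : ℕ) where

    Scattered : ℕ → List V → Set
    Scattered k cs = All P cs × AllPairs (λ x y → ¬ Within d x y) cs × length cs ≤ k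
      × (length cs ≡ k ⊎ (∀ x → P x → Any (Within d x) cs))

    -- Greedy choice: uncovered vertices of `P` are added until there are `k` of them or none is
    -- left.
    scatter : ∀ k → ∃ (Scattered k)
    scatter zero = [] , [] , [] , z≤n , inj₁ refl
    scatter (suc k) with scatter k
    ... | cs , ps , far , le , inj₂ cov = cs , ps , far , ≤-trans le (n≤1+n k) , inj₂ cov
    ... | cs , ps , far , le , inj₁ len
        with any? (λ x → P? x ×-dec ¬? (Any.any? (within? d x) cs))
    ...   | yes (x , px , ¬near) = x ∷ cs , px ∷ ps , ¬Any⇒All¬ cs ¬near ∷ far , s≤s le , inj₁ (cong suc len)
    ...   | no none = cs , ps , far , ≤-trans le (n≤1+n k) , inj₂ cov
      where
      cov : ∀ x → P x → Any (Within d x) cs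
      cov x px with Any.any? (within? d x) cs
      ... | yes near = near
      ... | no ¬near = ⊥-elim (none (x , px , ¬near))

  module Centres {N : ℕ} (κ : V → Fin N) (rs : List ℕ) (k : ℕ) where

    -- Spacing by twice the span keeps two centres from being close to the same vertex, and one
    -- centre more than the tuple has entries makes the pigeonhole principle apply.
    centres : (θ : Fin (types N rs 1)) →
              ∃ (Scattered (λ x → code κ rs (x ∷ []) ≟F θ) (span rs + span rs) (suc k))
    centres θ = scatter (λ x → code κ rs (x ∷ []) ≟F θ) (span rs + span rs) (suc k)

    closeness : V → Fin (types N rs 1) → Fin (suc k) → Bool
    closeness x θ = at (λ c → ⌊ within? (span rs) c x ⌋) (proj₁ (centres θ))

  -- The centres belong to types over the colours for one move fewer and one entry more, so they are
  -- fixed before their closeness enters the new colour.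
  refine : ∀ {N} q k → (V → Fin N) → V → Fin (colours q k N)
  refine zero    k κ x = κ x
  refine (suc q) k κ x = combine (refine q (suc k) κ x)
    (funToFin λ θ → funToFin λ j → bit (Centres.closeness (refine q (suc k) κ) (radii q) k x θ j))

  refine-refines : ∀ {N} q k {κ : V → Fin N} {x y} → refine q k κ x ≡ refine q k κ y → κ x ≡ κ y
  refine-refines zero    k eq = eq
  refine-refines (suc q) k {κ} {x} {y} eq =
    refine-refines q (suc k) (combine-injectiveˡ (refine q (suc k) κ x) _ (refine q (suc k) κ y) _ eq)

  -- The Ehrenfeucht-Fraïssé game with `q` unrestricted moves.
  Equivalent : ∀ {k N} → (V → Fin N) → ℕ → Vec V k → Vec V k → Set
  Equivalent κ zero    xs ys = Atomic κ xs ys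
  Equivalent κ (suc q) xs ys = Atomic κ xs ys
    × (∀ a → ∃ λ b → Equivalent κ q (a ∷ xs) (b ∷ ys))
    × (∀ b → ∃ λ a → Equivalent κ q (b ∷ ys) (a ∷ xs))

  -- A vertex a far from xs is answered by a centre of its type that is far from ys.  If
  -- no centre is far from ys, then the centres cover the type of a (there are too many of
  -- them to be all close to ys otherwise), and a is close to xs because the colours record
  -- which centres are close.
  respond : ∀ {k N} (κ : V → Fin N) rs (let open Centres κ rs k; d = span rs) {xs ys : Vec V k} →
            (∀ i θ j → closeness (lookup xs i) θ j ≡ closeness (lookup ys i) θ j) →
            Similar κ rs xs ys → ∀ a → ¬ Near (d + d + d) a xs →
            ∃ λ b → Similar κ rs (a ∷ xs) (b ∷ ys)
  respond {k} κ rs {xs} {ys} same sim a far with Centres.centres κ rs k (code κ rs (a ∷ [])) in eqc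
  ... | cs , typed , scattered , le , rest
      with any? (λ i → ¬? (near? (span rs) (List.lookup cs i) ys))
  ...   | yes (i , ¬near) = b , subst₂ (λ us vs → Similar κ rs (a ∷ us) (b ∷ vs)) (mix-rights xs) (mix-rights ys)
            (compose rs (left (rights k)) apart apart′
               (code⇒similar rs (≡.sym (All.lookup typed (∈-lookup i)))) sim)
      where
      d = span rs
      b = List.lookup cs i
      apart : Apart d (a ∷ []) xs
      apart zero j w = far (j , lengthen (m≤n+m d (d + d)) w)
      apart′ : Apart d (b ∷ []) ys
      apart′ zero j w = ¬near (j , w)
  ...   | no all-near = ⊥-elim (absurd rest)
      where
      d = span rs
      near : ∀ i → Near d (List.lookup cs i) ys
      near i with near? d (List.lookup cs i) ys
      ... | yes p = p
      ... | no ¬p = ⊥-elim (all-near (i , ¬p))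
      near-xs : ∀ i → Near d (List.lookup cs i) xs
      near-xs i with near i | at-lookup cs le i
      ... | j , w | m , at-m = j , dec-eq⇒ {a? = within? d c (lookup ys j)} {within? d c (lookup xs j)} bits w
        where
        c = List.lookup cs i
        same′ : at (λ c → ⌊ within? d c (lookup xs j) ⌋) cs m ≡ at (λ c → ⌊ within? d c (lookup ys j) ⌋) cs m
        same′ = subst (λ C → at (λ c → ⌊ within? d c (lookup xs j) ⌋) (proj₁ C) m
                           ≡ at (λ c → ⌊ within? d c (lookup ys j) ⌋) (proj₁ C) m) eqc
                      (same j (code κ rs (a ∷ [])) m)
        bits : ⌊ within? d c (lookup ys j) ⌋ ≡ ⌊ within? d c (lookup xs j) ⌋
        bits = trans (≡.sym (at-m _)) (trans (≡.sym same′) (at-m _))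
      absurd : ¬ (length cs ≡ suc k ⊎ (∀ x → code κ rs (x ∷ []) ≡ code κ rs (a ∷ []) → Any (Within (d + d) x) cs))
      absurd (inj₁ len) with pigeonhole {k} (≤-reflexive (≡.sym len)) (λ i → proj₁ (near i))
      ... | i , j , i<j , eq = allPairs-lookup scattered i<j
            (proj₂ (near i) ++ʷ subst (λ m → Within d (lookup ys m) _) (≡.sym eq) (within-sym (proj₂ (near j))))
      absurd (inj₂ cov) with cov a refl
      ... | any with Any.index any | lookup-index any
      ...   | i | w with near-xs i
      ...     | j , w′ = far (j , (w ++ʷ w′))

  -- A move near the tuple is answered by similarity, a far one by `respond`. Both answers give
  -- similar tuples over the coarser colours `κ₁`, to which the induction hypothesis applies.
  locality : ∀ {N} q {k} {κ : V → Fin N} {xs ys : Vec V k} →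
             Similar (refine q k κ) (radii q) xs ys → Equivalent κ q xs ys
  locality zero    sim = sim
  locality (suc q) {k} {κ} {xs} {ys} sim@(sim₀ , f , g) =
    coarsen-atomic {xs} {ys} (similar⇒atomic (radii (suc q)) {xs} {ys} sim)
    , forth sim₀ f , forth (similar-sym (radii q) sim₀) g
    where
    κ₁ = refine q (suc k) κ
    κ′ = refine (suc q) k κ
    rs = radii q
    κ′⇒κ₁ : ∀ {x y} → κ′ x ≡ κ′ y → κ₁ x ≡ κ₁ y
    κ′⇒κ₁ {x} {y} = combine-injectiveˡ (κ₁ x) _ (κ₁ y) _
    coarsen-atomic : ∀ {xs ys} → Atomic κ′ xs ys → Atomic κ xs ys
    coarsen-atomic (c , l) = (λ i → refine-refines (suc q) k (c i)) , l
    forth : ∀ {xs ys} (let r = span rs + span rs + span rs) → Similar κ′ rs xs ys →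
            (∀ a → Near r a xs → ∃ λ b → Near r b ys × Similar κ′ rs (a ∷ xs) (b ∷ ys)) →
            ∀ a → ∃ λ b → Equivalent κ q (a ∷ xs) (b ∷ ys)
    forth {xs} {ys} sim f a with near? (span rs + span rs + span rs) a xs
    ... | yes near = let b , _ , s = f a near in b , locality q (coarsen rs κ′⇒κ₁ s)
    ... | no far = let b , s = respond κ₁ rs same (coarsen rs κ′⇒κ₁ sim) a far in b , locality q s
      where
      same : ∀ i θ j → Centres.closeness κ₁ rs k (lookup xs i) θ j ≡ Centres.closeness κ₁ rs k (lookup ys i) θ j
      same i θ j = bit-injective (funToFin-injective {f = bits (lookup xs i) θ} {bits (lookup ys i) θ}
        (funToFin-injective {f = λ θ → funToFin (bits (lookup xs i) θ)} {λ θ → funToFin (bits (lookup ys i) θ)}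
          (combine-injectiveʳ (κ₁ (lookup xs i)) _ (κ₁ (lookup ys i)) _
            (proj₁ (similar⇒atomic rs {xs} {ys} sim) i)) θ) j)
        where
        bits : V → Fin (types _ rs 1) → Fin (suc k) → Fin 2
        bits x θ j = bit (Centres.closeness κ₁ rs k x θ j)

-- Formulas on the copy expansion

T-⇔⇒≡ : ∀ {a b} → (T a → T b) → (T b → T a) → a ≡ b
T-⇔⇒≡ {false} {false} f g = refl
T-⇔⇒≡ {false} {true}  f g = ⊥-elim (g _)
T-⇔⇒≡ {true}  {false} f g = ⊥-elim (f _)
T-⇔⇒≡ {true}  {true}  f g = refl

depth : ∀ {U m} → Formula U m → ℕ
depth (eqᶠ _ _)   = 0
depth (edgeᶠ _ _) = 0
depth (simᶠ _ _)  = 0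
depth (unᶠ _ _)   = 0
depth (¬ᶠ φ)      = depth φ
depth (φ ∨ᶠ ψ)    = depth φ ⊔ depth ψ
depth (∃ᶠ φ)      = suc (depth φ)

-- Formulas speak of `G`, whereas locality is applied to another graph `e` on the same vertices. The
-- hypotheses on `κ` let the atomic facts of `G` be read off from `e` and the colours.
module Evaluation (G : Graph) {p m : ℕ} (params : Fin p → Fin (size G) → Bool)
                  (e : Fin (size G) → Fin (size G) → Bool) (e-sym : ∀ x y → e x y ≡ e y x)
                  {N : ℕ} (κ : Fin (size G) → Fin N)
                  (κ-params : ∀ {x y} → κ x ≡ κ y → ∀ a → params a x ≡ params a y)
                  (κ-adj : ∀ {x y x′ y′} → κ x ≡ κ x′ → κ y ≡ κ y′ → e x y ≡ e x′ y′ →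
                           adj G x y ≡ adj G x′ y′)
                  where

  open Local e e-sym

  S : Structure (Fin p ⊎ Fin m)
  S = copyExpansion G p m params

  equivalent⇒atomic : ∀ {k} q {xs ys : Vec V k} → Equivalent κ q xs ys → Atomic κ xs ys
  equivalent⇒atomic zero    at = at
  equivalent⇒atomic (suc q) eq = proj₁ eq

  Over : ∀ {k} → Vec V k → (Fin k → Fin m) → (Fin k → V × Fin m) → Set
  Over xs ι ρ = ∀ i → ρ i ≡ (lookup xs i , ι i)

  over-extend : ∀ {k x c} {xs : Vec V k} {ι ρ} → Over xs ι ρ → Over (x ∷ xs) (extend c ι) (extend (x , c) ρ)
  over-extend o zero    = refl
  over-extend o (suc i) = o i

  -- Induction on the formula along the game. A quantifier picks a vertex and a copy index: the
  -- vertex is answered by a move, the copy index is kept.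
  preserves : ∀ {k q} (φ : Formula (Fin p ⊎ Fin m) k) → depth φ ≤ q → ∀ {xs ys : Vec V k} {ι ρ ρ′} →
              Equivalent κ q xs ys → Over xs ι ρ → Over ys ι ρ′ → ⟦ φ ⟧ S ρ ≡ ⟦ φ ⟧ S ρ′
  preserves {q = q} (eqᶠ i j) _ {xs} {ys} {ι} eq o o′ rewrite o i | o j | o′ i | o′ j =
    cong (_∧ (ι i == ι j)) (link⇒== (proj₂ (equivalent⇒atomic q {xs} {ys} eq) i j))
  preserves {q = q} (edgeᶠ i j) _ {xs} {ys} {ι} eq o o′ rewrite o i | o j | o′ i | o′ j =
    let c , l = equivalent⇒atomic q {xs} {ys} eq in
    cong ((ι i == ι j) ∧_) (κ-adj (c i) (c j) (link⇒e (l i j)))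
  preserves {q = q} (simᶠ i j) _ {xs} {ys} eq o o′ rewrite o i | o j | o′ i | o′ j =
    link⇒== (proj₂ (equivalent⇒atomic q {xs} {ys} eq) i j)
  preserves {q = q} (unᶠ (inj₁ a) i) _ {xs} {ys} eq o o′ rewrite o i | o′ i =
    κ-params (proj₁ (equivalent⇒atomic q {xs} {ys} eq) i) a
  preserves (unᶠ (inj₂ _) i) _ eq o o′ rewrite o i | o′ i = refl
  preserves (¬ᶠ φ) le {xs} {ys} eq o o′ = cong not (preserves φ le {xs} {ys} eq o o′)
  preserves (φ ∨ᶠ ψ) le {xs} {ys} eq o o′ =
    cong₂ _∨_ (preserves φ (m⊔n≤o⇒m≤o (depth φ) (depth ψ) le) {xs} {ys} eq o o′)
              (preserves ψ (m⊔n≤o⇒n≤o (depth φ) (depth ψ) le) {xs} {ys} eq o o′)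
  preserves {q = suc q} (∃ᶠ φ) (s≤s le) {xs} {ys} {ι} (_ , f , g) o o′ =
    T-⇔⇒≡ (transfer {xs} {ys} f o o′) (transfer {ys} {xs} g o′ o)
    where
    transfer : ∀ {xs ys ρ ρ′} → (∀ a → ∃ λ b → Equivalent κ q (a ∷ xs) (b ∷ ys)) →
               Over xs ι ρ → Over ys ι ρ′ → T (⟦ ∃ᶠ φ ⟧ S ρ) → T (⟦ ∃ᶠ φ ⟧ S ρ′)
    transfer {xs} {ys} {ρ} f o o′ t
      with Any.satisfied (any⁻ (λ x → ⟦ φ ⟧ S (extend x ρ)) (Structure.elems S) t)
    ... | (a , c) , holds with f a
    ...   | b , eq = any⁺ _ (Any.map
              (λ { refl → subst T (preserves φ le {a ∷ xs} {b ∷ ys} eq (over-extend o) (over-extend o′)) holds })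
              (∈-cartesianProduct⁺ (∈-allFin b) (∈-allFin c)))

  -- Far apart vertices do not interact, so their single types compose to the type of the pair, from
  -- which `locality` gives the truth value.
  determined : (φ : Formula (Fin p ⊎ Fin m) 2) (let rs = radii (depth φ); κ′ = refine (depth φ) 2 κ) →
               ∀ {u v u′ v′} i j →
               code κ′ rs (u ∷ []) ≡ code κ′ rs (u′ ∷ []) → code κ′ rs (v ∷ []) ≡ code κ′ rs (v′ ∷ []) →
               ¬ Within (span rs) u v → ¬ Within (span rs) u′ v′ →
               ⟦ φ ⟧ S (env2 (u , i) (v , j)) ≡ ⟦ φ ⟧ S (env2 (u′ , i) (v′ , j))
  determined φ {u} {v} {u′} {v′} i j equ eqv far far′ =
    preserves φ ≤-refl {ι = env2 i j} (locality (depth φ)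
      (compose rs (left (right done)) {u ∷ []} {u′ ∷ []} {v ∷ []} {v′ ∷ []}
        (λ { zero zero → far }) (λ { zero zero → far′ })
        (code⇒similar rs equ) (code⇒similar rs eqv)))
      (λ { zero → refl ; (suc zero) → refl }) (λ { zero → refl ; (suc zero) → refl })
    where rs = radii (depth φ)

-- Isolating a short list of vertices

baseColours : ℕ → ℕ → ℕ
baseColours p M = 2 ^ p * (2 ^ M * 2 ^ M)

-- Isolating the vertices of a short list R changes the graph, but the old adjacency is
-- recovered from colours that record for every vertex its position in R and its neighbours in R.
module Removal (G : Graph) {p : ℕ} (params : Fin p → Fin (size G) → Bool)
               (R : List (Fin (size G))) {M : ℕ} (short : List.length R ≤ M) where

  infix 4 _∈R?
  _∈R? : ∀ x → Dec (x ∈ R)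
  x ∈R? = Any.any? (x ≟F_) R

  e : Fin (size G) → Fin (size G) → Bool
  e x y = adj G x y ∧ (not ⌊ x ∈R? ⌋ ∧ not ⌊ y ∈R? ⌋)

  e-sym : ∀ x y → e x y ≡ e y x
  e-sym x y = cong₂ _∧_ (Graph.sym G x y) (Bool.∧-comm (not ⌊ x ∈R? ⌋) (not ⌊ y ∈R? ⌋))

  paramsCode : Fin (size G) → Fin (2 ^ p)
  paramsCode x = funToFin λ (a : Fin p) → bit (params a x)

  positionCode neighboursCode : Fin (size G) → Fin (2 ^ M)
  positionCode x = funToFin λ (j : Fin M) → bit (at (x ==_) R j)
  neighboursCode x = funToFin λ (j : Fin M) → bit (at (adj G x) R j)

  κ : Fin (size G) → Fin (baseColours p M)
  κ x = combine (paramsCode x) (combine (positionCode x) (neighboursCode x))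

  module _ {x y} (eq : κ x ≡ κ y) where

    private
      split₁ = combine-injective (paramsCode x) _ (paramsCode y) _ eq
      split₂ = combine-injective (positionCode x) _ (positionCode y) _ (proj₂ split₁)
      same-position : ∀ (j : Fin M) → at (x ==_) R j ≡ at (y ==_) R j
      same-position j = bit-injective (funToFin-injective (proj₁ split₂) j)
      same-neighbours : ∀ (j : Fin M) → at (adj G x) R j ≡ at (adj G y) R j
      same-neighbours j = bit-injective (funToFin-injective (proj₂ split₂) j)

    κ-params : ∀ a → params a x ≡ params a y
    κ-params a = bit-injective (funToFin-injective (proj₁ split₁) a)

    -- The position bit at an index of `x` in `R` is true for no other vertex.
    κ-∈ : x ∈ R → x ≡ y
    κ-∈ x∈ with at-lookup R short (Any.index x∈)
    ... | j , at-j = trans x≡c (≡.sym (dec-eq⇒ {a? = x ≟F c} {y ≟F c} bits x≡c))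
      where
      c = List.lookup R (Any.index x∈)
      x≡c = lookup-index x∈
      bits : (x == c) ≡ (y == c)
      bits = trans (≡.sym (at-j (x ==_))) (trans (same-position j) (at-j (y ==_)))

    κ-neighbours : ∀ {c} → c ∈ R → adj G x c ≡ adj G y c
    κ-neighbours c∈ with at-lookup R short (Any.index c∈)
    ... | j , at-j = subst (λ c → adj G x c ≡ adj G y c) (≡.sym (lookup-index c∈))
      (trans (≡.sym (at-j (adj G x))) (trans (same-neighbours j) (at-j (adj G y))))

  κ-adj : ∀ {x y x′ y′} → κ x ≡ κ x′ → κ y ≡ κ y′ → e x y ≡ e x′ y′ → adj G x y ≡ adj G x′ y′
  κ-adj {x} {y} {x′} {y′} eqx eqy eqe with x ∈R? | y ∈R?
  ... | yes x∈ | _ with κ-∈ eqx x∈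
  ...   | refl = trans (Graph.sym G x y) (trans (κ-neighbours eqy x∈) (Graph.sym G y′ x))
  κ-adj {x} {y} {x′} {y′} eqx eqy eqe | no _ | yes y∈ with κ-∈ eqy y∈
  ... | refl = κ-neighbours eqx y∈
  κ-adj {x} {y} {x′} {y′} eqx eqy eqe | no x∉ | no y∉ with x′ ∈R? | y′ ∈R?
  ... | yes x′∈ | _ = ⊥-elim (x∉ (subst (_∈ R) (κ-∈ (≡.sym eqx) x′∈) x′∈))
  ... | no _ | yes y′∈ = ⊥-elim (y∉ (subst (_∈ R) (κ-∈ (≡.sym eqy) y′∈) y′∈))
  ... | no _ | no _ = trans (≡.sym (Bool.∧-identityʳ _)) (trans eqe (Bool.∧-identityʳ _))

  e⇒adj : ∀ {x y} → e x y ≡ true → adj G x y ≡ true × ¬ x ∈ R × ¬ y ∈ R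
  e⇒adj {x} {y} exy with adj G x y | x ∈R? | y ∈R?
  ... | true  | no x∉ | no y∉ = refl , x∉ , y∉
  ... | true  | yes _ | _ with () ← exy
  ... | true  | no _ | yes _ with () ← exy
  ... | false | _ | _ with () ← exy

-- Generalised colouring numbers

≤-maxOver : ∀ {n} (f : Fin n → ℕ) v → f v ≤ maxOver f
≤-maxOver f v = bound (∈-allFin v)
  where
  bound : ∀ {xs} → v ∈ xs → f v ≤ List.foldr _⊔_ 0 (List.map f xs)
  bound (here refl) = m≤m⊔n _ _
  bound (there v∈) = ≤-trans (bound v∈) (m≤n⊔m _ _)

maxOver-≤ : ∀ {n b} (f : Fin n → ℕ) → (∀ v → f v ≤ b) → maxOver f ≤ b
maxOver-≤ {n} {b} f f≤b = bound (List.allFin n)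
  where
  bound : ∀ xs → List.foldr _⊔_ 0 (List.map f xs) ≤ b
  bound []       = z≤n
  bound (x ∷ xs) = ⊔-lub (f≤b x) (bound xs)

members : ∀ {n} → (Fin n → Bool) → List (Fin n)
members {n} p = List.filter (λ u → p u Bool.≟ true) (List.allFin n)

length-members : ∀ {n} (p : Fin n → Bool) → length (members p) ≡ count p
length-members {n} p = go (List.allFin n)
  where
  go : ∀ xs → length (List.filter (λ u → p u Bool.≟ true) xs) ≡ sum (List.map (λ u → if p u then 1 else 0) xs)
  go []       = refl
  go (x ∷ xs) with p x
  ... | true  = cong suc (go xs)
  ... | false = go xs

∈-members : ∀ {n} {p : Fin n → Bool} {u} → p u ≡ true → u ∈ members p
∈-members {p = p} {u} = ∈-filter⁺ (λ u → p u Bool.≟ true) (∈-allFin u)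

unique-⊆-length : ∀ {A : Set} {xs ys : List A} → Unique xs → (∀ {x} → x ∈ xs → x ∈ ys) → length xs ≤ length ys
unique-⊆-length {xs = xs} {ys} unique xs⊆ys = injective⇒≤ {f = λ i → Any.index (xs⊆ys (∈-lookup i))} injective
  where
  injective : ∀ {i j} → Any.index (xs⊆ys (∈-lookup i)) ≡ Any.index (xs⊆ys (∈-lookup j)) → i ≡ j
  injective {i} {j} eq = by-order (<-cmp (toℕ i) (toℕ j))
    where
    same : List.lookup xs i ≡ List.lookup xs j
    same = trans (lookup-index (xs⊆ys (∈-lookup i)))
          (trans (cong (List.lookup ys) eq) (≡.sym (lookup-index (xs⊆ys (∈-lookup j)))))
    by-order : _ → i ≡ j
    by-order (tri< i<j _ _) = ⊥-elim (allPairs-lookup unique i<j same)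
    by-order (tri≈ _ i≡j _) = toℕ-injective i≡j
    by-order (tri> _ _ j<i) = ⊥-elim (allPairs-lookup unique j<i (≡.sym same))

-- The upper bounds on the colouring numbers of the decomposition rest on this: it suffices to list
-- a superset, with repetitions allowed.
count-≤-cover : ∀ {n} {p : Fin n → Bool} (cs : List (Fin n)) →
                (∀ {u} → p u ≡ true → u ∈ cs) → count p ≤ length cs
count-≤-cover {n} {p} cs covers = ≤-trans (≤-reflexive (≡.sym (length-members p)))
  (unique-⊆-length (Unique.filter⁺ (λ u → p u Bool.≟ true) (Unique.allFin⁺ n))
    (λ u∈ → covers (proj₂ (∈-filter⁻ (λ u → p u Bool.≟ true) {xs = List.allFin n} u∈))))

length-concatMap-≤ : ∀ {A B : Set} {f : A → List B} {b} xs → (∀ x → length (f x) ≤ b) →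
                     length (List.concatMap f xs) ≤ length xs * b
length-concatMap-≤         []       f≤b = z≤n
length-concatMap-≤ {f = f} (x ∷ xs) f≤b =
  ≤-trans (≤-reflexive (length-++ (f x))) (+-mono-≤ (f≤b x) (length-concatMap-≤ xs f≤b))

∈-concatMap : ∀ {A B : Set} {f : A → List B} {x y xs} → x ∈ xs → y ∈ f x → y ∈ List.concatMap f xs
∈-concatMap {f = f} x∈ y∈ = ∈-concatMap⁺ f (lose x∈ y∈)

T-∧⁺ : ∀ {a b} → T a → T b → T (a ∧ b)
T-∧⁺ ta tb = Equivalence.from Bool.T-∧ (ta , tb)

T-∧⁻ : ∀ {a b} → T (a ∧ b) → T a × T b
T-∧⁻ = Equivalence.to Bool.T-∧

T⇒≡ : ∀ {a} → T a → a ≡ true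
T⇒≡ = Equivalence.to Bool.T-≡

≡⇒T : ∀ {a} → a ≡ true → T a
≡⇒T = Equivalence.from Bool.T-≡

T-== : ∀ {n} {x y : Fin n} → T (x == y) → x ≡ y
T-== {x = x} {y} t with x ≟F y
... | yes eq = eq

==-T : ∀ {n} {x y : Fin n} → x ≡ y → T (x == y)
==-T {x = x} refl with x ≟F x
... | yes _ = _
... | no ¬eq = ⊥-elim (¬eq refl)

-- From searching for paths to walks

module Search (G : Graph) (ok : Fin (size G) → Bool) where

  Step : Fin (size G) → Fin (size G) → Set
  Step a b = adj G a b ≡ true × T (ok a) × T (ok b)

  -- The common part of `reach` and `wreach`, with the condition on the vertices of a path
  -- abstracted to `ok`.
  search : ℕ → Fin (size G) → Fin (size G) → Bool
  search r v u = any (λ P → endsAt u P ∧ distinct P ∧ all ok P) (walksUpTo G r v)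

  data Path (u : Fin (size G)) : ℕ → Fin (size G) → List (Fin (size G)) → Set where
    end  : Path u 0 u (u ∷ [])
    link : ∀ {k v w P} → adj G v w ≡ true → Path u k w P → Path u (suc k) v (v ∷ P)

  path-∈ : ∀ {u k v P} → Path u k v P → P ∈ walks G k v
  path-∈ end = here refl
  path-∈ {v = v} (link {k} {w = w} {P} vw path) = ∈-concatMap (∈-allFin w) member
    where
    member : v ∷ P ∈ (if adj G v w then List.map (v ∷_) (walks G k w) else [])
    member rewrite vw = ∈-map⁺ (v ∷_) (path-∈ path)

  path-endsAt : ∀ {u k v P} → Path u k v P → T (endsAt u P)
  path-endsAt end = ==-T refl
  path-endsAt (link _ end) = ==-T refl
  path-endsAt (link _ path@(link _ _)) = path-endsAt path

  walks-path : ∀ k {v u P} → P ∈ walks G k v → T (endsAt u P) → Path u k v P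
  walks-path zero    (here refl) t with T-== t
  ... | refl = end
  walks-path (suc k) {v} {u} P∈ t
    with find (∈-concatMap⁻ (λ w → if adj G v w then List.map (v ∷_) (walks G k w) else [])
                           {xs = List.allFin (size G)} P∈)
  ... | w , _ , P∈w with adj G v w in vw
  ...   | true with ∈-map⁻ (v ∷_) P∈w
  -- `endsAt` reduces only once the tail is split; the tail is never empty, since a listed walk
  -- contains its start.
  ...     | [] , P′∈ , refl = ⊥-elim (nonempty k P′∈)
    where
    nonempty : ∀ k {w} → ¬ [] ∈ walks G k w
    nonempty zero    (here ())
    nonempty (suc k) {w} []∈
      with find (∈-concatMap⁻ (λ x → if adj G w x then List.map (w ∷_) (walks G k x) else [])
                             {xs = List.allFin (size G)} []∈)
    ... | x , _ , []∈x with adj G w x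
    ...   | true with ∈-map⁻ (w ∷_) []∈x
    ...     | ()
  ...     | y ∷ P , P′∈ , refl = link vw (walks-path k P′∈ t)

  unique⇒distinct : ∀ {P} → Unique P → T (distinct P)
  unique⇒distinct []       = _
  unique⇒distinct (x ∷ xs) = T-∧⁺ (fresh x) (unique⇒distinct xs)
    where
    fresh : ∀ {x : Fin (size G)} {P} → All (x ≢_) P → T (not (any (x ==_) P))
    fresh []        = _
    fresh {x} {y ∷ _} (x≢y ∷ x≢) with x ≟F y
    ... | yes x≡y = ⊥-elim (x≢y x≡y)
    ... | no _    = fresh x≢

  Simple : ℕ → Fin (size G) → Fin (size G) → Set
  Simple r v u = ∃₂ λ k P → k ≤ r × Path u k v P × Unique P × All (T ∘ ok) P

  suffix : ∀ {u k w v P} → Path u k w P → v ∈ P → Unique P → All (T ∘ ok) P → Simple k v u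
  suffix end           (here refl) unique oks = _ , _ , ≤-refl , end , unique , oks
  suffix (link e path) (here refl) unique oks = _ , _ , ≤-refl , link e path , unique , oks
  suffix (link e path) (there v∈) (_ ∷ unique) (_ ∷ oks) with suffix path v∈ unique oks
  ... | k , P , k≤ , rest = k , P , ≤-trans k≤ (n≤1+n _) , rest

  -- Loop erasure: if the new first vertex already lies on the simple path, the path is cut back to
  -- that occurrence.
  simplify : ∀ {r v u} → T (ok v) → Walk Step r v u → Simple r v u
  simplify okv stay = 0 , _ , z≤n , end , ([] ∷ []) , (okv ∷ [])
  simplify {v = v} okv (step (vw , _ , okw) walk) with simplify okw walk
  ... | k , P , k≤ , path , unique , oks with Any.any? (v ≟F_) P
  ...   | yes v∈ = let k′ , P′ , k′≤ , rest = suffix path v∈ unique oks in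
                   k′ , P′ , ≤-trans k′≤ (≤-trans k≤ (n≤1+n _)) , rest
  ...   | no v∉ = suc k , v ∷ P , s≤s k≤ , link vw path , (¬Any⇒All¬ P v∉ ∷ unique) , (okv ∷ oks)

  search-complete : ∀ {r v u} → T (ok v) → Walk Step r v u → T (search r v u)
  search-complete {r} {v} {u} okv walk with simplify okv walk
  ... | k , P , k≤ , path , unique , oks = any⁺ _ (lose
    (∈-concatMap {f = λ k → walks G k v} (∈-upTo⁺ (s≤s k≤)) (path-∈ path))
    (T-∧⁺ (path-endsAt path) (T-∧⁺ {distinct P} (unique⇒distinct unique) (all⁻ ok oks))))

  search-sound : ∀ {r v u} → T (search r v u) → Walk Step r v u
  search-sound {r} {v} {u} t
    with find (any⁻ (λ P → endsAt u P ∧ distinct P ∧ all ok P) (walksUpTo G r v) t)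
  ... | P , P∈ , conds with find (∈-concatMap⁻ (λ k → walks G k v) {xs = List.upTo (suc r)} P∈) | T-∧⁻ {endsAt u P} conds
  ...   | k , k∈ , P∈k | ends , conds′ =
    lengthen (s≤s⁻¹ (∈-upTo⁻ k∈)) (walk (walks-path k P∈k ends) (all⁺ ok P (proj₂ (T-∧⁻ {distinct P} conds′))))
    where
    head-ok : ∀ {u k w P} → Path u k w P → All (T ∘ ok) P → T (ok w)
    head-ok end        (okw ∷ _) = okw
    head-ok (link _ _) (okw ∷ _) = okw
    walk : ∀ {u k w P} → Path u k w P → All (T ∘ ok) P → Walk Step k w u
    walk end            _           = stay
    walk (link wx path) (okw ∷ oks) = step (wx , okw , head-ok path oks) (walk path oks)

-- The number of nodes of the complete `d`-ary tree of depth `r`.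
downSize : ℕ → ℕ → ℕ
downSize d zero    = 1
downSize d (suc r) = suc (d * downSize d r)

-- Weak and strong reachability in an ordered graph

module Order (G : Graph) (σ : Fin (size G) → ℕ) where

  private V = Fin (size G)

  Above : V → V → V → Set
  Above m a b = adj G a b ≡ true × σ m ≤ σ a × σ m ≤ σ b

  above-sym : ∀ {m a b} → Above m a b → Above m b a
  above-sym {a = a} {b} (ab , ma , mb) = trans (Graph.sym G b a) ab , mb , ma

  above-lower : ∀ {m m′ a b} → σ m′ ≤ σ m → Above m a b → Above m′ a b
  above-lower le (ab , ma , mb) = ab , ≤-trans le ma , ≤-trans le mb

  WReach : ℕ → V → V → Set
  WReach r u w = Walk (Above w) r u w

  wreach? : ∀ r u w → Dec (WReach r u w)
  wreach? r u w = walk? (λ a b → (adj G a b Bool.≟ true) ×-dec (σ w ≤? σ a) ×-dec (σ w ≤? σ b)) r u w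

  wreach-≤ : ∀ {r u w} → WReach r u w → σ w ≤ σ u
  wreach-≤ stay                  = ≤-refl
  wreach-≤ (step (_ , wu , _) _) = wu

  WReach⇒wreach : ∀ {r u w} → WReach r u w → wreach G σ r u w ≡ true
  WReach⇒wreach {r} {u} {w} walk = T⇒≡ (Search.search-complete G (λ x → σ w ≤ᵇ σ x)
    (≤⇒≤ᵇ (wreach-≤ walk)) (weaken (λ (ab , wa , wb) → ab , ≤⇒≤ᵇ wa , ≤⇒≤ᵇ wb) ≤-refl walk))

  Guard : V → V → V → Set
  Guard w y a = a ≡ y ⊎ σ w ≤ σ a

  Guarded : V → V → V → V → Set
  Guarded w y a b = adj G a b ≡ true × Guard w y a × Guard w y b

  SReach : ℕ → V → V → Set
  SReach r w y = Walk (Guarded w y) r w y × σ y ≤ σ w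

  SReach⇒reach : ∀ {r w y} → SReach r w y → reach G σ r w y ≡ true
  SReach⇒reach {r} {w} {y} (walk , y≤w) = T⇒≡ (T-∧⁺ (≤⇒≤ᵇ y≤w)
    (Search.search-complete G (λ x → (x == y) ∨ (σ w ≤ᵇ σ x)) (guard (inj₂ ≤-refl))
      (weaken (λ (ab , ga , gb) → ab , guard ga , guard gb) ≤-refl walk)))
    where
    guard : ∀ {a} → Guard w y a → T ((a == y) ∨ (σ w ≤ᵇ σ a))
    guard (inj₁ a≡y) = Equivalence.from Bool.T-∨ (inj₁ (==-T a≡y))
    guard (inj₂ w≤a) = Equivalence.from Bool.T-∨ (inj₂ (≤⇒≤ᵇ w≤a))

  -- The witness is the first vertex of the walk that is at most `w` in the order; it exists because
  -- `x` is such a vertex.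
  exit : ∀ {r a x} w → σ x ≤ σ w → Walk (Above x) r a x →
         ∃ λ y → Walk (Guarded w y) r a y × Guard w y a × σ y ≤ σ w × WReach r y x
  exit {a = a} w x≤w walk with σ a ≤? σ w
  exit {a = a} w x≤w walk | yes a≤w = a , stay , inj₁ refl , a≤w , walk
  exit w x≤w stay | no a≰w = ⊥-elim (a≰w x≤w)
  exit w x≤w (step (ab , _) walk) | no a≰w with exit w x≤w walk
  ... | y , walk′ , guard , y≤w , rest =
    y , step (ab , inj₂ (≰⇒≥ a≰w) , guard) walk′ , inj₂ (≰⇒≥ a≰w) , y≤w , lengthen (n≤1+n _) rest

  reached wreached : ℕ → V → List V
  reached r u = members (reach G σ r u)
  wreached r u = members (wreach G σ r u)

  ∈-reached : ∀ {r u y} → SReach r u y → y ∈ reached r u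
  ∈-reached {r} {u} walk = ∈-members {p = reach G σ r u} (SReach⇒reach walk)

  ∈-wreached : ∀ {r u w} → WReach r u w → w ∈ wreached r u
  ∈-wreached {r} {u} walk = ∈-members {p = wreach G σ r u} (WReach⇒wreach walk)

  length-reached : ∀ r u → length (reached r u) ≤ col r G σ
  length-reached r u = ≤-trans (≤-reflexive (length-members (reach G σ r u))) (≤-maxOver _ u)

  length-wreached : ∀ r u → length (wreached r u) ≤ wcol r G σ
  length-wreached r u = ≤-trans (≤-reflexive (length-members (wreach G σ r u))) (≤-maxOver _ u)

  down : ℕ → ℕ → V → List V
  down R zero    u = u ∷ []
  down R (suc r) u = u ∷ List.concatMap (down R r) (reached R u)

  length-down : ∀ R r u → length (down R r u) ≤ downSize (col R G σ) r
  length-down R zero    u = ≤-refl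
  length-down R (suc r) u = s≤s (≤-trans (length-concatMap-≤ (reached R u) (length-down R r))
                                         (*-monoˡ-≤ _ (length-reached R u)))

  -- After its first step the walk is cut at the first vertex that is at most `u`. This vertex is
  -- strongly reachable from `u`, and a shorter weak walk remains. Thus weak reachability is bounded
  -- in terms of `col`.
  wreach-down : ∀ {R r u x} → r ≤ R → WReach r u x → x ∈ down R r u
  wreach-down {r = zero}  r≤R stay = here refl
  wreach-down {r = suc _} r≤R stay = here refl
  wreach-down {R} {suc r} {u} r≤R walk@(step (ab , x≤u , _) rest) with exit u x≤u rest
  ... | y , walk′ , guard , y≤u , rest′ = there (∈-concatMap {f = down R r}
    (∈-reached (lengthen r≤R (step (ab , inj₂ ≤-refl , guard) walk′) , y≤u))
    (wreach-down (≤-trans (n≤1+n r) r≤R) rest′))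

  -- Going back from `w` to `u` and on to `x` stays above `x`, because `x` is the lower of the two
  -- ends.
  wreach-wreach : ∀ {r u w x} → WReach r u w → WReach r u x → σ x ≤ σ w → WReach (r + r) w x
  wreach-wreach uw ux x≤w = reverse above-sym (weaken (above-lower x≤w) ≤-refl uw) ++ʷ ux

  -- The witness is a lowest vertex of the walk, so both parts of the walk stay above it. `P` holds
  -- at the start and at the end of each edge, hence at every vertex of the walk.
  lowest : ∀ {E : V → V → Set} {P : V → Set} {r u v} → (∀ {a b} → E a b → adj G a b ≡ true × P b) → P u →
           Walk E r u v → ∃ λ m → P m × σ m ≤ σ u × Walk (Above m) r u v × WReach r u m × Walk (Above m) r m v
  lowest {u = u} E⇒ pu stay = u , pu , ≤-refl , stay , stay , stay
  lowest {u = u} E⇒ pu (step e walk) with lowest E⇒ (proj₂ (E⇒ e)) walk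
  ... | m , pm , m≤z , zv , zm , mv with σ m ≤? σ u
  ...   | yes m≤u = m , pm , m≤u , step e′ zv , step e′ zm , lengthen (n≤1+n _) mv
    where e′ = proj₁ (E⇒ e) , m≤u , m≤z
  ...   | no m≰u = u , pu , ≤-refl , uv , stay , uv
    where uv = step (proj₁ (E⇒ e) , ≤-refl , ≤-trans (≰⇒≥ m≰u) m≤z) (weaken (above-lower (≰⇒≥ m≰u)) ≤-refl zv)

  meet : ∀ {E : V → V → Set} {P : V → Set} {r u v} → (∀ {a b} → E a b → adj G a b ≡ true × P b) → P u →
         Walk E r u v → ∃ λ m → P m × WReach r u m × WReach r v m
  meet E⇒ pu walk with lowest E⇒ pu walk
  ... | m , pm , _ , _ , um , mv = m , pm , um , reverse above-sym mv

-- Assembling a lacon-decomposition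

argmax : ∀ {n} (g : Fin n → ℕ) {P : Fin n → Set} → (∀ x → Dec (P x)) → ∃ P →
         ∃ λ x → P x × (∀ y → P y → g y ≤ g x)
argmax {zero}  g P? (() , _)
argmax {suc n} g {P} P? found with any? (λ x → P? (suc x))
... | no none with found
...   | zero  , p0 = zero , p0 , λ { zero _ → ≤-refl ; (suc y) py → ⊥-elim (none (y , py)) }
...   | suc x , px = ⊥-elim (none (x , px))
argmax {suc n} g {P} P? found | yes found′ with argmax (g ∘ suc) (P? ∘ suc) found′ | P? zero
... | x , px , max | no ¬p0 = suc x , px , λ { zero p0 → ⊥-elim (¬p0 p0) ; (suc y) → max y }
... | x , px , max | yes p0 with g zero ≤? g (suc x)
...   | yes le = suc x , px , λ { zero _ → le ; (suc y) → max y }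
...   | no  gt = zero , p0 , λ { zero _ → ≤-refl ; (suc y) py → ≤-trans (max y py) (≰⇒≥ gt) }

-- A slot is an unordered pair of codes or, above all pairs, a single code.  The last slot
-- hit by both γ and δ therefore determines the unordered pair {γ , δ}.
module Slots (K : ℕ) where

  slots : ℕ
  slots = K * K + K

  Hit′ : Fin (K * K) ⊎ Fin K → Fin K → Set
  Hit′ (inj₁ c) γ = γ ≡ proj₁ (remQuot {K} K c) ⊎ γ ≡ proj₂ (remQuot {K} K c)
  Hit′ (inj₂ α) γ = γ ≡ α

  Hit : Fin slots → Fin K → Set
  Hit j = Hit′ (splitAt (K * K) j)

  hit? : ∀ j γ → Dec (Hit j γ)
  hit? j γ with splitAt (K * K) j
  ... | inj₁ c = (γ ≟F _) ⊎-dec (γ ≟F _)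
  ... | inj₂ α = γ ≟F α

  common-slot : ∀ γ δ → ∃ λ j → Hit j γ × Hit j δ
  common-slot γ δ = combine γ δ ↑ˡ K , hits
    where
    hits : Hit (combine γ δ ↑ˡ K) γ × Hit (combine γ δ ↑ˡ K) δ
    hits rewrite splitAt-↑ˡ (K * K) (combine γ δ) K =
      inj₁ (≡.sym (cong proj₁ (remQuot-combine γ δ))) , inj₂ (≡.sym (cong proj₂ (remQuot-combine γ δ)))

  Last : Fin slots → Fin K → Fin K → Set
  Last j γ δ = Hit j γ × Hit j δ × (∀ j′ → Hit j′ γ → Hit j′ δ → toℕ j′ ≤ toℕ j)

  -- The single slot of `γ` is also hit and lies above all slots for pairs.
  last-distinct : ∀ {j c γ} → splitAt (K * K) j ≡ inj₁ c → ¬ Last j γ γ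
  last-distinct {c = c} {γ} eq (_ , _ , last) with splitAt⁻¹-↑ˡ eq
  ... | refl = <⇒≱ below (last (K * K ↑ʳ γ) hit hit)
    where
    hit : Hit (K * K ↑ʳ γ) γ
    hit rewrite splitAt-↑ʳ (K * K) K γ = refl
    below : toℕ (c ↑ˡ K) < toℕ (K * K ↑ʳ γ)
    below rewrite toℕ-↑ˡ c K | toℕ-↑ʳ (K * K) γ = <-≤-trans (toℕ<n c) (m≤m+n (K * K) (toℕ γ))

  last-unique : ∀ {j γ δ γ′ δ′} → Last j γ δ → Last j γ′ δ′ → (γ ≡ γ′ × δ ≡ δ′) ⊎ (γ ≡ δ′ × δ ≡ γ′)
  last-unique {j} l l′ with splitAt (K * K) j in eq | l | l′
  ... | inj₂ α | refl , refl , _ | refl , refl , _ = inj₁ (refl , refl)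
  ... | inj₁ c | inj₁ refl , inj₁ refl , _ | _ = ⊥-elim (last-distinct eq l)
  ... | inj₁ c | inj₂ refl , inj₂ refl , _ | _ = ⊥-elim (last-distinct eq l)
  ... | inj₁ c | _ | inj₁ refl , inj₁ refl , _ = ⊥-elim (last-distinct eq l′)
  ... | inj₁ c | _ | inj₂ refl , inj₂ refl , _ = ⊥-elim (last-distinct eq l′)
  ... | inj₁ c | inj₁ refl , inj₂ refl , _ | inj₁ refl , inj₂ refl , _ = inj₁ (refl , refl)
  ... | inj₁ c | inj₁ refl , inj₂ refl , _ | inj₂ refl , inj₁ refl , _ = inj₂ (refl , refl)
  ... | inj₁ c | inj₂ refl , inj₁ refl , _ | inj₁ refl , inj₂ refl , _ = inj₂ (refl , refl)
  ... | inj₁ c | inj₂ refl , inj₁ refl , _ | inj₂ refl , inj₁ refl , _ = inj₁ (refl , refl)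

-- Place zero lies below all vertices; it serves the targets that see no common vertex.
Place : ℕ → Set
Place n = Fin (suc n)

rank : ∀ {n} → (Fin n → ℕ) → Place n → ℕ
rank σ zero    = 0
rank σ (suc w) = suc (σ w)

Top : ∀ {n} {Target : Set} (σ : Fin n → ℕ) (Sees : Place n → Target → Set) → Place n → Target → Target → Set
Top σ Sees ℓ t t′ = Sees ℓ t × Sees ℓ t′ × (∀ ℓ′ → Sees ℓ′ t → Sees ℓ′ t′ → rank σ ℓ′ ≤ rank σ ℓ)

top-swap : ∀ {n} {Target : Set} (σ : Fin n → ℕ) (Sees : Place n → Target → Set) {ℓ t t′} →
           Top σ Sees ℓ t t′ → Top σ Sees ℓ t′ t
top-swap σ Sees (st , st′ , max) = st′ , st , λ ℓ′ a b → max ℓ′ b a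

module Assembly
  (D : Graph) {n : ℕ} (σ : Fin n → ℕ) (σ-inj : IsLinearOrder σ) (K : ℕ)
  (Sees : Place n → Fin (size D) → Set) (sees? : ∀ ℓ t → Dec (Sees ℓ t)) (sees-zero : ∀ t → Sees zero t)
  (codeOf : Place n → Fin (size D) → Fin K)
  (agree : ∀ {ℓ t t′ u u′} → Top σ Sees ℓ t t′ → Top σ Sees ℓ u u′ →
           codeOf ℓ t ≡ codeOf ℓ u → codeOf ℓ t′ ≡ codeOf ℓ u′ →
           t ≢ t′ → u ≢ u′ → adj D t t′ ≡ adj D u u′)
  where

  open Slots K

  Target : Set
  Target = Fin (size D)

  B : ℕ
  B = slots

  Key : Set
  Key = Place n × Fin B

  -- The lexicographic order by place and then by slot, since slot numbers stay below `B`.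
  key : Key → ℕ
  key (ℓ , j) = rank σ ℓ * B + toℕ j

  key<suc-rank : ∀ ℓ j → key (ℓ , j) < suc (rank σ ℓ) * B
  key<suc-rank ℓ j = ≤-trans (+-monoʳ-< (rank σ ℓ * B) (toℕ<n j)) (≤-reflexive (+-comm (rank σ ℓ * B) B))

  key-≤⇒rank-≤ : ∀ {ℓ j ℓ′ j′} → key (ℓ , j) ≤ key (ℓ′ , j′) → rank σ ℓ ≤ rank σ ℓ′
  key-≤⇒rank-≤ {ℓ} {j} {ℓ′} {j′} le = ≮⇒≥ λ lt →
    <⇒≱ (<-≤-trans (key<suc-rank ℓ′ j′) (≤-trans (*-monoˡ-≤ B lt) (m≤m+n _ (toℕ j)))) le

  rank-injective : ∀ {ℓ ℓ′} → rank σ ℓ ≡ rank σ ℓ′ → ℓ ≡ ℓ′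
  rank-injective {zero}  {zero}  _  = refl
  rank-injective {suc _} {suc _} eq = cong suc (σ-inj (suc-injective eq))

  key-injective : ∀ {k k′} → key k ≡ key k′ → k ≡ k′
  key-injective {ℓ , j} {ℓ′ , j′} eq
    with rank-injective (≤-antisym (key-≤⇒rank-≤ {ℓ} {j} {ℓ′} {j′} (≤-reflexive eq))
                                   (key-≤⇒rank-≤ {ℓ′} {j′} {ℓ} {j} (≤-reflexive (≡.sym eq))))
  ... | refl = cong (ℓ ,_) (toℕ-injective (+-cancelˡ-≡ (rank σ ℓ * B) _ _ eq))

  -- Ranks are at most `suc (maxOver σ)`; the second `suc` makes room for the block of `B` keys at
  -- the highest rank.
  ceiling : ℕ
  ceiling = suc (suc (maxOver σ)) * B

  key<ceiling : ∀ k → key k < ceiling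
  key<ceiling (ℓ , j) = <-≤-trans (key<suc-rank ℓ j) (*-monoˡ-≤ B (s≤s (rank-≤ ℓ)))
    where
    rank-≤ : ∀ ℓ → rank σ ℓ ≤ suc (maxOver σ)
    rank-≤ zero    = z≤n
    rank-≤ (suc w) = s≤s (≤-maxOver σ w)

  Node : Set
  Node = Target ⊎ Key

  h′ : ℕ
  h′ = suc n * B

  unpack : Fin h′ → Key
  unpack = remQuot B

  node : Fin (size D + h′) → Node
  node a = Sum.map₂ unpack (splitAt (size D) a)

  index : Node → Fin (size D + h′)
  index (inj₁ t)       = t ↑ˡ h′
  index (inj₂ (ℓ , j)) = size D ↑ʳ combine ℓ j

  index-node : ∀ a → index (node a) ≡ a
  index-node a with splitAt (size D) a in eq
  ... | inj₁ t = splitAt⁻¹-↑ˡ eq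
  ... | inj₂ x = trans (cong (size D ↑ʳ_) (combine-remQuot {suc n} B x)) (splitAt⁻¹-↑ʳ eq)

  node-injective : ∀ {a b} → node a ≡ node b → a ≡ b
  node-injective {a} {b} eq = trans (≡.sym (index-node a)) (trans (cong index eq) (index-node b))

  height : Node → ℕ
  height (inj₁ t) = ceiling + toℕ t
  height (inj₂ k) = key k

  key<target : ∀ k (t : Target) → key k < ceiling + toℕ t
  key<target k t = <-≤-trans (key<ceiling k) (m≤m+n ceiling (toℕ t))

  height-injective : ∀ {a b} → height a ≡ height b → a ≡ b
  height-injective {inj₁ t} {inj₁ t′} eq = cong inj₁ (toℕ-injective (+-cancelˡ-≡ ceiling _ _ eq))
  height-injective {inj₁ t} {inj₂ k}  eq = ⊥-elim (<-irrefl (≡.sym eq) (key<target k t))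
  height-injective {inj₂ k} {inj₁ t}  eq = ⊥-elim (<-irrefl eq (key<target k t))
  height-injective {inj₂ k} {inj₂ k′} eq = cong inj₂ (key-injective eq)

  π′ : Fin (size D + h′) → ℕ
  π′ a = height (node a)

  Joined : Target → Key → Set
  Joined t (ℓ , j) = Sees ℓ t × Hit j (codeOf ℓ t)

  joined? : ∀ t k → Dec (Joined t k)
  joined? t (ℓ , j) = sees? ℓ t ×-dec hit? j (codeOf ℓ t)

  N′ : Target → Fin h′ → Bool
  N′ t x = ⌊ joined? t (unpack x) ⌋

  N′⇒joined : ∀ {t x} → N′ t x ≡ true → Joined t (unpack x)
  N′⇒joined eq = toWitness (≡⇒T eq)

  joined⇒N′ : ∀ {t ℓ j} → Joined t (ℓ , j) → N′ t (combine ℓ j) ≡ true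
  joined⇒N′ {t} {ℓ} {j} jn = T⇒≡ (fromWitness (subst (Joined t) (≡.sym (remQuot-combine ℓ j)) jn))

  π′-hidden : ∀ x → π′ (size D ↑ʳ x) ≡ key (unpack x)
  π′-hidden x rewrite splitAt-↑ʳ (size D) h′ x = refl

  π′-target : ∀ t → π′ (t ↑ˡ h′) ≡ ceiling + toℕ t
  π′-target t rewrite splitAt-↑ˡ (size D) t h′ = refl

  Dom : Target → Target → Fin h′ → Set
  Dom t t′ x = N′ t x ≡ true × N′ t′ x ≡ true
    × (∀ y → N′ t y ≡ true → N′ t′ y ≡ true → π′ (size D ↑ʳ y) ≤ π′ (size D ↑ʳ x))

  dom? : ∀ t t′ x → Dec (Dom t t′ x)
  dom? t t′ x = (N′ t x Bool.≟ true) ×-dec (N′ t′ x Bool.≟ true) ×-dec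
    all? (λ y → (N′ t y Bool.≟ true) →-dec ((N′ t′ y Bool.≟ true) →-dec (π′ (size D ↑ʳ y) ≤? π′ (size D ↑ʳ x))))

  -- By `common-slot`, each place seen by both targets carries a hidden vertex joined to both. Hence
  -- the largest key has the largest common place and, within it, the last common slot.
  dom⇒top : ∀ {t t′ x} → Dom t t′ x → let ℓ , j = unpack x in
            Top σ Sees ℓ t t′ × Last j (codeOf ℓ t) (codeOf ℓ t′)
  dom⇒top {t} {t′} {x} (tx , t′x , max) =
    (proj₁ jt , proj₁ jt′ , λ ℓ′ st st′ →
      let j′ , ht , ht′ = common-slot (codeOf ℓ′ t) (codeOf ℓ′ t′) in
      key-≤⇒rank-≤ {j = j′} (max-key (st , ht) (st′ , ht′)))
    , proj₂ jt , proj₂ jt′ , λ j′ ht ht′ → +-cancelˡ-≤ (rank σ ℓ * B) _ _ (max-key (proj₁ jt , ht) (proj₁ jt′ , ht′))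
    where
    ℓ = proj₁ (unpack x)
    jt = N′⇒joined {t} {x} tx
    jt′ = N′⇒joined {t′} {x} t′x
    max-key : ∀ {ℓ′ j′} → Joined t (ℓ′ , j′) → Joined t′ (ℓ′ , j′) → key (ℓ′ , j′) ≤ key (unpack x)
    max-key {ℓ′} {j′} a b = subst₂ _≤_
      (trans (π′-hidden (combine ℓ′ j′)) (cong key (remQuot-combine ℓ′ j′))) (π′-hidden x)
      (max (combine ℓ′ j′) (joined⇒N′ a) (joined⇒N′ b))

  dom-agree : ∀ {t t′ u u′ x} → Dom t t′ x → Dom u u′ x → t ≢ t′ → u ≢ u′ → adj D t t′ ≡ adj D u u′
  dom-agree {t} {t′} {u} {u′} {x} dom dom′ t≢t′ u≢u′ with dom⇒top {t} {t′} {x} dom | dom⇒top {u} {u′} {x} dom′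
  ... | top , last | top′ , last′ with last-unique {proj₂ (unpack x)} last last′
  ...   | inj₁ (eq , eq′) = agree top top′ eq eq′ t≢t′ u≢u′
  ...   | inj₂ (eq , eq′) = trans (agree top (top-swap σ Sees top′) eq eq′ t≢t′ (u≢u′ ∘ ≡.sym)) (Graph.sym D u′ u)

  -- One adjacent dominated pair decides the label; by `dom-agree` all pairs of distinct targets
  -- dominated by the same hidden vertex then behave alike.
  Labelled : Fin h′ → Set
  Labelled x = ∃₂ λ t t′ → t ≢ t′ × Dom t t′ x × adj D t t′ ≡ true

  labelled? : ∀ x → Dec (Labelled x)
  labelled? x = any? λ t → any? λ t′ → ¬? (t ≟F t′) ×-dec dom? t t′ x ×-dec (adj D t t′ Bool.≟ true)

  common′ : ∀ t t′ → ∃ λ x → N′ t x ≡ true × N′ t′ x ≡ true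
  common′ t t′ = let j , ht , ht′ = common-slot (codeOf zero t) (codeOf zero t′) in
    combine {suc n} zero j , joined⇒N′ (sees-zero t , ht) , joined⇒N′ (sees-zero t′ , ht′)

  dominant : ∀ t t′ → ∃ (Dom t t′)
  dominant t t′ with argmax (λ x → π′ (size D ↑ʳ x))
                            (λ x → (N′ t x Bool.≟ true) ×-dec (N′ t′ x Bool.≟ true)) (common′ t t′)
  ... | x , (tx , t′x) , max = x , tx , t′x , λ y ty t′y → max y (ty , t′y)

  decomposition : LaconDecomposition D
  decomposition = record
    { h = h′
    ; N = N′
    ; label = λ x → ⌊ labelled? x ⌋
    ; π = π′
    ; π-inj = λ {a} {b} eq → node-injective (height-injective {node a} {node b} eq)
    ; hidden-first = λ t x → subst₂ _<_ (≡.sym (π′-hidden x)) (≡.sym (π′-target t)) (key<target (unpack x) t)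
    ; common = common′
    ; represents = λ t t′ t≢t′ →
        (λ tt′ → let x , dom = dominant t t′ in
           x , dom , T⇒≡ (fromWitness {a? = labelled? x} (t , t′ , t≢t′ , dom , tt′)))
      , (λ { (x , dom , lab) → let u , u′ , u≢u′ , dom′ , uu′ = toWitness {a? = labelled? x} (≡⇒T lab) in
           trans (dom-agree dom dom′ t≢t′ u≢u′) uu′ })
    }

-- Adjacency is determined by local types

separation : Transduction → ℕ
separation τ = span (radii (depth (φ τ)))

-- Two vertices weakly reachable from one vertex are joined through it, which doubles the distance,
-- as in `wreach-wreach`.
blowup : Transduction → ℕ
blowup τ = separation τ + separation τ

typeColours codes : Transduction → ℕ → ℕ
typeColours τ M = colours (depth (φ τ)) 2 (baseColours (p τ) M)
codes τ M = types (typeColours τ M) (radii (depth (φ τ))) 1 * m τ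

module Visibility (G : Graph) (σ : Fin (size G) → ℕ) {Target : Set} (s : ℕ) (v : Target → Fin (size G)) where

  open Order G σ

  Sees : Place (size G) → Target → Set
  Sees zero    t = ⊤
  Sees (suc w) t = WReach s (v t) w

  sees? : ∀ ℓ t → Dec (Sees ℓ t)
  sees? zero    t = yes tt
  sees? (suc w) t = wreach? s (v t) w

  TopPlace : Place (size G) → Target → Target → Set
  TopPlace = Top σ Sees

module Agreement (τ : Transduction) (G : Graph) (σ : Fin (size G) → ℕ)
                 (D : Graph) (D∈ : D ∈⟦ τ ⟧ G) (M : ℕ)
                 (short : ∀ w → length (Order.down G σ (blowup τ) (blowup τ) w) ≤ M) where

  open _∈⟦_⟧_ D∈ using (params; f; f-inj; f-edges)
  open Order G σ

  private
    q = depth (φ τ)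
    s = separation τ
    c = blowup τ
    Vertex = Fin (size G)
    Target = Fin (size D)

  v : Target → Vertex
  v t = proj₁ (f t)

  open Visibility G σ s v

  removed : Place (size G) → List Vertex
  removed zero    = []
  removed (suc w) = down c c w

  removed-short : ∀ ℓ → length (removed ℓ) ≤ M
  removed-short zero    = z≤n
  removed-short (suc w) = short w

  module Rest (ℓ : Place (size G)) where
    open Removal G params (removed ℓ) (removed-short ℓ) public
    open Local e e-sym public
    open Evaluation G {m = m τ} params e e-sym κ κ-params κ-adj using (determined) public

    κ′ : Vertex → Fin (typeColours τ M)
    κ′ = refine q 2 κ

    typeOf : Vertex → Fin (types (typeColours τ M) (radii q) 1)
    typeOf x = code κ′ (radii q) (x ∷ [])

    typeOf⇒κ : ∀ {x y} → typeOf x ≡ typeOf y → κ x ≡ κ y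
    typeOf⇒κ {x} {y} eq = refine-refines q 2
      (proj₁ (similar⇒atomic (radii q) {x ∷ []} {y ∷ []} (code⇒similar (radii q) eq)) zero)

  codeOf : Place (size G) → Target → Fin (codes τ M)
  codeOf ℓ t = combine (Rest.typeOf ℓ (v t)) (proj₂ (f t))

  -- By maximality `x` is at most the top vertex, which therefore weakly reaches it through `v t`.
  -- If the top is place zero, there is no common vertex at all.
  common⇒removed : ∀ {ℓ t t′ x} → TopPlace ℓ t t′ → WReach s (v t) x → WReach s (v t′) x → x ∈ removed ℓ
  common⇒removed {zero}  (_ , _ , max) tx t′x with () ← max (suc _) tx t′x
  common⇒removed {suc w} (tw , _ , max) tx t′x =
    wreach-down ≤-refl (wreach-wreach tw tx (s≤s⁻¹ (max (suc _) tx t′x)))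

  -- A short walk would have a lowest vertex weakly reachable from both ends, so a removed one. But
  -- a walk with an edge visits no removed vertex, as these are isolated.
  separated : ∀ {ℓ t t′} → TopPlace ℓ t t′ → v t ≢ v t′ → ¬ Rest.Within ℓ s (v t) (v t′)
  separated {ℓ} {t} {t′} top v≢v′ walk = go ≤-refl walk v≢v′ (λ tx t′x → common⇒removed top tx t′x)
    where
    open Rest ℓ
    go : ∀ {r x y} → r ≤ s → Within r x y → x ≢ y →
         ¬ (∀ {z} → WReach s x z → WReach s y z → z ∈ removed ℓ)
    go r≤s stay x≢y _ = x≢y refl
    go r≤s walk@(step xz _) _ common
      with meet (λ e → proj₁ (e⇒adj e) , proj₂ (proj₂ (e⇒adj e))) (proj₁ (proj₂ (e⇒adj xz))) walk
    ... | z , z∉ , xz′ , yz = z∉ (common (lengthen r≤s xz′) (lengthen r≤s yz))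

  type-eq : ∀ ℓ {t u} → codeOf ℓ t ≡ codeOf ℓ u → Rest.typeOf ℓ (v t) ≡ Rest.typeOf ℓ (v u)
  type-eq ℓ {t} {u} = combine-injectiveˡ (Rest.typeOf ℓ (v t)) _ (Rest.typeOf ℓ (v u)) _

  copy-eq : ∀ ℓ {t u} → codeOf ℓ t ≡ codeOf ℓ u → proj₂ (f t) ≡ proj₂ (f u)
  copy-eq ℓ {t} {u} = combine-injectiveʳ (Rest.typeOf ℓ (v t)) _ (Rest.typeOf ℓ (v u)) _

  removed-determined : ∀ ℓ {t u} → codeOf ℓ t ≡ codeOf ℓ u → v t ∈ removed ℓ → t ≡ u
  removed-determined ℓ eq t∈ =
    f-inj (cong₂ _,_ (κ-∈ (typeOf⇒κ (type-eq ℓ eq)) t∈) (copy-eq ℓ eq))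
    where open Rest ℓ

  -- Two copies of one vertex are never far apart, so `determined` cannot treat them. Their vertex
  -- is a common one, hence removed, and so the codes identify the targets themselves.
  coincide : ∀ {ℓ t t′ u u′} → TopPlace ℓ t t′ → codeOf ℓ t ≡ codeOf ℓ u → codeOf ℓ t′ ≡ codeOf ℓ u′ →
             v t ≡ v t′ → t ≡ u × t′ ≡ u′
  coincide {ℓ} {t} {t′} {u} {u′} top eq eq′ same =
    removed-determined ℓ eq t∈ , removed-determined ℓ eq′ (subst (_∈ removed ℓ) same t∈)
    where
    t∈ : v t ∈ removed ℓ
    t∈ = common⇒removed top stay (subst (λ x → WReach s x (v t)) same stay)

  agree : ∀ {ℓ t t′ u u′} → TopPlace ℓ t t′ → TopPlace ℓ u u′ → codeOf ℓ t ≡ codeOf ℓ u → codeOf ℓ t′ ≡ codeOf ℓ u′ →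
          t ≢ t′ → u ≢ u′ → adj D t t′ ≡ adj D u u′
  agree {ℓ} {t} {t′} {u} {u′} top top′ eq eq′ t≢t′ u≢u′ with v t ≟F v t′ | v u ≟F v u′
  ... | yes same | _ with coincide top eq eq′ same
  ...   | refl , refl = refl
  agree {ℓ} {t} {t′} {u} {u′} top top′ eq eq′ t≢t′ u≢u′ | no _ | yes same
    with coincide top′ (≡.sym eq) (≡.sym eq′) same
  ... | refl , refl = refl
  agree {ℓ} {t} {t′} {u} {u′} top top′ eq eq′ t≢t′ u≢u′ | no v≢ | no v≢′ =
    trans (f-edges t t′ t≢t′) (trans (cong₂ _∨_ (half top top′ eq eq′ v≢ v≢′)
      (half (top-swap σ Sees top) (top-swap σ Sees top′) eq′ eq (v≢ ∘ ≡.sym) (v≢′ ∘ ≡.sym))) (≡.sym (f-edges u u′ u≢u′)))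
    where
    open Rest ℓ
    S′ = copyExpansion G (p τ) (m τ) params
    half : ∀ {t t′ u u′} → TopPlace ℓ t t′ → TopPlace ℓ u u′ → codeOf ℓ t ≡ codeOf ℓ u → codeOf ℓ t′ ≡ codeOf ℓ u′ →
           v t ≢ v t′ → v u ≢ v u′ → ⟦ φ τ ⟧ S′ (env2 (f t) (f t′)) ≡ ⟦ φ τ ⟧ S′ (env2 (f u) (f u′))
    half {t} {t′} {u} {u′} top top′ eq eq′ v≢ v≢′ =
      trans (determined (φ τ) (proj₂ (f t)) (proj₂ (f t′)) (type-eq ℓ eq) (type-eq ℓ eq′)
               (separated top v≢) (separated top′ v≢′))
            (cong₂ (λ i j → ⟦ φ τ ⟧ S′ (env2 (v u , i) (v u′ , j))) (copy-eq ℓ eq) (copy-eq ℓ eq′))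


-- Bounds on the colouring numbers

walk-bind : ∀ {A V : Set} {E : A → A → Set} {F : V → V → Set} {s r x y} (g : A → V) →
            (∀ {a b} → E a b → Walk F s (g a) (g b)) → Walk E r x y → Walk F (r * s) (g x) (g y)
walk-bind g E⇒F stay       = stay
walk-bind g E⇒F (step e w) = E⇒F e ++ʷ walk-bind g E⇒F w

nonempty : ∀ {A : Set} {x : A} {xs} → x ∈ xs → 1 ≤ length xs
nonempty (here _)  = s≤s z≤n
nonempty (there _) = s≤s z≤n

-- The summands that do not grow with `X` are absorbed into the factor by means of `1 ≤ X`.
cover-size : ∀ {n M X} B → 1 ≤ X → n ≤ X * suc M → suc (B + n * B) ≤ suc (B + suc M * B) * X
cover-size {n} {M} {X@(suc _)} B 1≤X n≤ = +-mono-≤ 1≤X (begin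
  B + n * B             ≤⟨ +-mono-≤ (m≤m*n B X) (*-monoˡ-≤ B n≤) ⟩
  B * X + X * suc M * B ≡⟨ cong (B * X +_) (trans (*-assoc X (suc M) B) (*-comm X (suc M * B))) ⟩
  B * X + suc M * B * X ≡⟨ *-distribʳ-+ X B (suc M * B) ⟨
  (B + suc M * B) * X   ∎)
  where open ≤-Reasoning

-- A walk of length r in the decomposition projects to a walk of length at most s * r in G, because
-- each of its edges comes from a weakly s-reachable vertex.
module Bounds
  (G : Graph) (σ : Fin (size G) → ℕ) (σ-inj : IsLinearOrder σ) (D : Graph) (K s M : ℕ)
  (v : Fin (size D) → Fin (size G)) (t₀ : Fin (size D))
  (short : ∀ w → length (Order.down G σ (s + s) (s + s) w) ≤ M)
  (codeOf : Place (size G) → Fin (size D) → Fin K)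
  (agree : ∀ {ℓ t t′ u u′} → Visibility.TopPlace G σ s v ℓ t t′ → Visibility.TopPlace G σ s v ℓ u u′ →
           codeOf ℓ t ≡ codeOf ℓ u → codeOf ℓ t′ ≡ codeOf ℓ u′ →
           t ≢ t′ → u ≢ u′ → adj D t t′ ≡ adj D u u′)
  where

  open Order G σ
  open Visibility G σ s v
  open Assembly D σ σ-inj K Sees sees? (λ _ → tt) codeOf agree public

  private
    c = s + s
    Vertex = Fin (size G)
    L′ = bipartite (size D) h′ N′

  Adjacent : Node → Node → Set
  Adjacent (inj₁ t) (inj₂ k) = Joined t k
  Adjacent (inj₂ k) (inj₁ t) = Joined t k
  Adjacent _        _        = ⊥

  adjacent : ∀ a b → adj L′ a b ≡ true → Adjacent (node a) (node b)
  adjacent a b ab with splitAt (size D) a | splitAt (size D) b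
  ... | inj₁ t | inj₂ x = N′⇒joined {t} {x} ab
  ... | inj₂ x | inj₁ t = N′⇒joined {t} {x} ab

  WeakStep : Node → Node → Node → Set
  WeakStep u a b = Adjacent a b × height u ≤ height a × height u ≤ height b

  Allowed : Node → Node → Node → Set
  Allowed v u a = a ≡ u ⊎ height v ≤ height a

  StrongStep : Node → Node → Node → Node → Set
  StrongStep v u a b = Adjacent a b × Allowed v u a × Allowed v u b

  wreach⇒walk : ∀ {r a u} → wreach L′ π′ r a u ≡ true → Walk (WeakStep (node u)) r (node a) (node u)
  wreach⇒walk {r} {a} {u} eq = walk-map (Search.search-sound L′ (λ x → π′ u ≤ᵇ π′ x) (≡⇒T eq))
    where
    walk-map : ∀ {r x} → Walk (Search.Step L′ (λ x → π′ u ≤ᵇ π′ x)) r x u → Walk (WeakStep (node u)) r (node x) (node u)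
    walk-map stay = stay
    walk-map (step {x = x} {y} (xy , ux , uy) w) = step (adjacent x y xy , ≤ᵇ⇒≤ _ _ ux , ≤ᵇ⇒≤ _ _ uy) (walk-map w)

  reach⇒walk : ∀ {r a u} → reach L′ π′ r a u ≡ true →
               π′ u ≤ π′ a × Walk (StrongStep (node a) (node u)) r (node a) (node u)
  reach⇒walk {r} {a} {u} eq with T-∧⁻ {π′ u ≤ᵇ π′ a} (≡⇒T eq)
  ... | le , found = ≤ᵇ⇒≤ _ _ le , walk-map (Search.search-sound L′ ok found)
    where
    ok : Fin (size D + h′) → Bool
    ok x = (x == u) ∨ (π′ a ≤ᵇ π′ x)
    allowed : ∀ x → T (ok x) → Allowed (node a) (node u) (node x)
    allowed x t with Equivalence.to (Bool.T-∨ {x == u}) t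
    ... | inj₁ x≡u = inj₁ (cong node (T-== x≡u))
    ... | inj₂ a≤x = inj₂ (≤ᵇ⇒≤ _ _ a≤x)
    walk-map : ∀ {r x} → Walk (Search.Step L′ ok) r x u → Walk (StrongStep (node a) (node u)) r (node x) (node u)
    walk-map stay = stay
    walk-map (step {x = x} {y} (xy , okx , oky) w) =
      step (adjacent x y xy , allowed x okx , allowed y oky) (walk-map w)

  -- Hidden vertices at place zero get the arbitrary position w.
  position : Vertex → Node → Vertex
  position w (inj₁ t)           = v t
  position w (inj₂ (zero , _))  = w
  position w (inj₂ (suc x , _)) = x

  segment : ∀ {w t ℓ j} → rank σ (suc w) ≤ rank σ ℓ → Sees ℓ t →
            Walk (Above w) s (v t) (position w (inj₂ (ℓ , j)))
  segment {ℓ = suc x} (s≤s w≤x) sees = weaken (above-lower w≤x) ≤-refl sees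

  sees-≤ : ∀ {w t ℓ} → rank σ (suc w) ≤ rank σ ℓ → Sees ℓ t → σ w ≤ σ (v t)
  sees-≤ {ℓ = suc x} (s≤s w≤x) sees = ≤-trans w≤x (wreach-≤ sees)

  -- Every edge has a hidden end, which lies below all targets, so the walk cannot move.
  weak-target : ∀ {r a t} → Walk (WeakStep (inj₁ t)) r a (inj₁ t) → a ≡ inj₁ t
  weak-target stay = refl
  weak-target {t = t} (step {x = inj₁ _} {inj₂ k} (_ , _ , le) _) = ⊥-elim (<⇒≱ (key<target k t) le)
  weak-target {t = t} (step {x = inj₂ k} {inj₁ _} (_ , le , _) _) = ⊥-elim (<⇒≱ (key<target k t) le)

  weak-project : ∀ {r a w j} → let u = inj₂ (suc w , j) in
                 Walk (WeakStep u) r a u → WReach (r * s) (position w a) w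
  weak-project {w = w} {j} = walk-bind (position w) λ {a} {b} → project {a} {b}
    where
    project : ∀ {a b} → WeakStep (inj₂ (suc w , j)) a b → Walk (Above w) s (position w a) (position w b)
    project {inj₁ t} {inj₂ (ℓ , j′)} ((sees , _) , _ , le) =
      segment {j = j′} (key-≤⇒rank-≤ {suc w} {j} {ℓ} {j′} le) sees
    project {inj₂ (ℓ , j′)} {inj₁ t} ((sees , _) , le , _) =
      reverse above-sym (segment {j = j′} (key-≤⇒rank-≤ {suc w} {j} {ℓ} {j′} le) sees)

  HighEnough : Vertex → Node → Set
  HighEnough w (inj₁ t)       = σ w ≤ σ (v t)
  HighEnough w (inj₂ (ℓ , _)) = rank σ (suc w) ≤ rank σ ℓ

  -- Up to the last step every vertex of the projected walk is at least w; only the segment that ends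
  -- at the low vertex w′ may leave this region, and it does so at a vertex strongly reachable from w.
  strong-project : ∀ {r a w j w′ j′} → HighEnough w a → σ w′ ≤ σ w →
                   let u = inj₂ (suc w′ , j′) in Walk (StrongStep (inj₂ (suc w , j)) u) r a u →
                   ∃ λ x → Walk (Guarded w x) (r * s) (position w a) x × σ x ≤ σ w × WReach s x w′
  strong-project {w′ = w′} high w′≤w stay = w′ , stay , w′≤w , stay
  strong-project {w = w} high w′≤w (step {x = inj₁ t} {inj₂ _} ((sees , _) , _ , inj₁ refl) _)
    with exit w w′≤w sees
  ... | x , walk , _ , x≤w , rest = x , lengthen (m≤m+n s _) walk , x≤w , rest
  strong-project {w = w} {j} high w′≤w (step {x = inj₁ t} {inj₂ (ℓ , j″)} ((sees , _) , _ , inj₂ le) walk)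
    with key-≤⇒rank-≤ {suc w} {j} {ℓ} {j″} le
  ... | high′ with strong-project {w = w} {j} high′ w′≤w walk
  ...   | x , walk′ , x≤w , rest =
    x , (weaken (λ (ab , wa , wb) → ab , inj₂ wa , inj₂ wb) ≤-refl (segment {j = j″} high′ sees) ++ʷ walk′) , x≤w , rest
  strong-project {w = w} {j} high w′≤w (step {x = inj₂ (ℓ , j″)} {inj₁ t} ((sees , _) , _ , _) walk)
    with strong-project {w = w} {j} (sees-≤ {t = t} high sees) w′≤w walk
  ... | x , walk′ , x≤w , rest =
    x , (weaken (λ (ab , wa , wb) → ab , inj₂ wa , inj₂ wb) ≤-refl
          (reverse above-sym (segment {j = j″} high sees)) ++ʷ walk′) , x≤w , rest

  -- Covers of the reachable vertices

  at-place : Place (size G) → List (Fin (size D + h′))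
  at-place ℓ = List.map (λ j → index (inj₂ (ℓ , j))) (List.allFin B)

  length-at-place : ∀ ℓ → length (at-place ℓ) ≤ B
  length-at-place ℓ = ≤-reflexive (trans (length-map _ (List.allFin B)) (length-tabulate {n = B} (λ j → j)))

  ∈-at-place : ∀ {a ℓ j} → node a ≡ inj₂ (ℓ , j) → a ∈ at-place ℓ
  ∈-at-place {a} {ℓ} {j} eq = subst (_∈ at-place ℓ) (trans (≡.sym (cong index eq)) (index-node a))
    (∈-map⁺ (λ j → index (inj₂ (ℓ , j))) (∈-allFin j))

  -- A target is reached only from itself, which `a` accounts for. Place zero carries just `B`
  -- hidden vertices and is listed as a whole, so only proper places have to be traced in `G`.
  cover : Fin (size D + h′) → List Vertex → List (Fin (size D + h′))
  cover a ws = a ∷ at-place zero List.++ List.concatMap (at-place ∘ suc) ws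

  length-cover : ∀ a ws → length (cover a ws) ≤ suc (B + length ws * B)
  length-cover a ws = s≤s (≤-trans (≤-reflexive (length-++ (at-place zero)))
    (+-mono-≤ (length-at-place zero) (length-concatMap-≤ ws (length-at-place ∘ suc))))

  covered-low : ∀ {a u ws j} → node u ≡ inj₂ (zero , j) → u ∈ cover a ws
  covered-low eq = there (∈-++⁺ˡ (∈-at-place eq))

  covered : ∀ {a u w ws j} → node u ≡ inj₂ (suc w , j) → w ∈ ws → u ∈ cover a ws
  covered eq w∈ = there (∈-++⁺ʳ (at-place zero) (∈-concatMap {f = at-place ∘ suc} w∈ (∈-at-place eq)))

  -- Hidden vertices at proper places are higher than those at place zero and not reachable from
  -- them; hence the empty list.
  around : (Vertex → List Vertex) → Node → List Vertex
  around near (inj₁ t)           = near (v t)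
  around near (inj₂ (zero , _))  = []
  around near (inj₂ (suc w , _)) = near w

  length-around : ∀ {near b} → (∀ w → length (near w) ≤ b) → ∀ a → length (around near a) ≤ b
  length-around le (inj₁ t)           = le (v t)
  length-around le (inj₂ (zero , _))  = z≤n
  length-around le (inj₂ (suc w , _)) = le w

  above-low : ∀ {w j j′} → ¬ key (suc w , j) ≤ key (zero , j′)
  above-low {w} {j} {j′} le with key-≤⇒rank-≤ {suc w} {j} {zero} {j′} le
  ... | ()

  module _ (r : ℕ) where

    scale : r * s ≤ c * r
    scale = ≤-trans (≤-reflexive (*-comm r s)) (*-monoˡ-≤ r (m≤m+n s s))

    -- `strongly-near` mirrors `strong-project`: a strongly reachable vertex, followed by the
    -- boundedly many vertices in its `down` list.
    weakly-near strongly-near : Vertex → List Vertex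
    weakly-near w   = wreached (c * r) w
    strongly-near w = List.concatMap (down c c) (reached (c * r) w)

    weak-around : ∀ {a w j} → let u = inj₂ (suc w , j) in Walk (WeakStep u) r a u → w ∈ around weakly-near a
    weak-around {a} {w} {j} walk = go a (lengthen scale (weak-project {a = a} walk)) walk
      where
      u = inj₂ (suc w , j)
      go : ∀ a → WReach (c * r) (position w a) w → Walk (WeakStep u) r a u → w ∈ around weakly-near a
      go (inj₁ t)               near _ = ∈-wreached {c * r} near
      go (inj₂ (suc _ , _))     near _ = ∈-wreached {c * r} near
      go (inj₂ (zero , j′))     near (step (_ , le , _) _) = ⊥-elim (above-low {w} {j} {j′} le)

    strong-around : ∀ {a w j} → let u = inj₂ (suc w , j) in
                    height u ≤ height a → Walk (StrongStep a u) r a u → w ∈ around strongly-near a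
    -- The first step from a target already ends at `u`, because every other hidden vertex is too
    -- low to be allowed.
    strong-around {inj₁ t} _ (step {y = inj₂ _} ((sees , _) , _ , inj₁ refl) _) =
      ∈-concatMap {f = down c c} (∈-reached {c * r} (stay , ≤-refl))
        (wreach-down ≤-refl (lengthen (m≤m+n s s) sees))
    strong-around {inj₁ t} _ (step {y = inj₂ k} (_ , _ , inj₂ le) _) = ⊥-elim (<⇒≱ (key<target k t) le)
    strong-around {inj₂ (zero , j′)} {w} {j} le _ = ⊥-elim (above-low {w} {j} {j′} le)
    strong-around {inj₂ (suc w′ , j′)} {w} {j} le walk
      with strong-project {w = w′} {j′} ≤-refl (s≤s⁻¹ (key-≤⇒rank-≤ {suc w} {j} {suc w′} {j′} le)) walk
    ... | x , walk′ , x≤w′ , rest =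
      ∈-concatMap {f = down c c} (∈-reached {c * r} (lengthen scale walk′ , x≤w′))
        (wreach-down ≤-refl (lengthen (m≤m+n s s) rest))

    strong-target : ∀ {a t} → height (inj₁ t) ≤ height a → Walk (StrongStep a (inj₁ t)) r a (inj₁ t) → a ≡ inj₁ t
    strong-target {inj₁ _} _ stay = refl
    strong-target {inj₁ t} _ (step {y = inj₂ k} (_ , _ , inj₂ le) _) = ⊥-elim (<⇒≱ (key<target k t) le)
    strong-target {inj₂ k} {t} le _ = ⊥-elim (<⇒≱ (key<target k t) le)

    wreach-covered : ∀ {a u} → wreach L′ π′ r a u ≡ true → u ∈ cover a (around weakly-near (node a))
    wreach-covered {a} {u} eq = go (node u) refl (wreach⇒walk {r} eq)
      where
      go : ∀ x → node u ≡ x → Walk (WeakStep x) r (node a) x → u ∈ cover a (around weakly-near (node a))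
      go (inj₁ t)           eq walk = here (node-injective (trans eq (≡.sym (weak-target walk))))
      go (inj₂ (zero , _))  eq walk = covered-low {ws = around weakly-near (node a)} eq
      go (inj₂ (suc _ , _)) eq walk = covered eq (weak-around walk)

    reach-covered : ∀ {a u} → reach L′ π′ r a u ≡ true → u ∈ cover a (around strongly-near (node a))
    reach-covered {a} {u} eq = go (node u) refl (proj₁ (reach⇒walk {r} eq)) (proj₂ (reach⇒walk {r} eq))
      where
      go : ∀ x → node u ≡ x → height x ≤ height (node a) → Walk (StrongStep (node a) x) r (node a) x →
           u ∈ cover a (around strongly-near (node a))
      go (inj₁ t)           eq le walk = here (node-injective (trans eq (≡.sym (strong-target le walk))))
      go (inj₂ (zero , _))  eq le walk = covered-low {ws = around strongly-near (node a)} eq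
      go (inj₂ (suc _ , _)) eq le walk = covered eq (strong-around le walk)

    1≤col : 1 ≤ col (c * r) G σ
    1≤col = ≤-trans (nonempty (∈-reached {c * r} {v t₀} (stay , ≤-refl))) (length-reached (c * r) (v t₀))

    1≤wcol : 1 ≤ wcol (c * r) G σ
    1≤wcol = ≤-trans (nonempty (∈-wreached {c * r} {v t₀} stay)) (length-wreached (c * r) (v t₀))

    length-strongly-near : ∀ w → length (strongly-near w) ≤ col (c * r) G σ * suc M
    length-strongly-near w = ≤-trans (length-concatMap-≤ (reached (c * r) w) short)
      -- Passing from `M` to `suc M` keeps the factor positive, so that `cover-size` also serves the
      -- weak bound.
      (*-mono-≤ (length-reached (c * r) w) (n≤1+n M))

    col-bound : col r L′ π′ ≤ suc (B + suc M * B) * col (c * r) G σ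
    col-bound = maxOver-≤ _ λ a → ≤-trans (count-≤-cover (cover a (around strongly-near (node a))) reach-covered)
      (≤-trans (length-cover a (around strongly-near (node a)))
        (cover-size B 1≤col (length-around length-strongly-near (node a))))

    wcol-bound : wcol r L′ π′ ≤ suc (B + suc M * B) * wcol (c * r) G σ
    wcol-bound = maxOver-≤ _ λ a → ≤-trans (count-≤-cover (cover a (around weakly-near (node a))) wreach-covered)
      (≤-trans (length-cover a (around weakly-near (node a)))
        (cover-size B 1≤wcol (≤-trans (length-around (length-wreached (c * r)) (node a)) (m≤m*n _ (suc M)))))

-- If `D` is empty, `G` may be empty as well and the right-hand sides zero; so hidden vertices must
-- be avoided altogether.
trivial : (D : Graph) → ¬ Fin (size D) → LaconDecomposition D
trivial D empty = record
  { h = 0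
  ; N = λ _ _ → false
  ; label = λ _ → false
  ; π = toℕ
  ; π-inj = toℕ-injective
  ; hidden-first = λ _ ()
  ; common = λ t → ⊥-elim (empty t)
  ; represents = λ t → ⊥-elim (empty t)
  }

inhabited? : ∀ n → Fin n ⊎ ¬ Fin n
inhabited? zero    = inj₂ λ ()
inhabited? (suc n) = inj₁ zero

theorem18 : (τ : Transduction) →
    Σ ℕ λ c → Σ (ℕ → ℕ) λ f →
    (G : Graph) (σ : Fin (size G) → ℕ) → IsLinearOrder σ →
    (D : Graph) → D ∈⟦ τ ⟧ G →
    Σ (LaconDecomposition D) λ Λ →
    (r : ℕ) →
    (col r (L Λ) (π Λ) ≤ f (col c G σ) * col (c * r) G σ) ×
    (wcol r (L Λ) (π Λ) ≤ f (col c G σ) * wcol (c * r) G σ)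
theorem18 τ = c , factor , decompose
  where
  s c : ℕ
  s = separation τ
  c = blowup τ
  listSize factor : ℕ → ℕ
  listSize d = downSize d c
  -- The summands count the vertex itself, the hidden vertices at place zero and those at the nearby
  -- proper places.
  factor d = let B = Slots.slots (codes τ (listSize d)) in suc (B + suc (listSize d) * B)
  decompose : (G : Graph) (σ : Fin (size G) → ℕ) → IsLinearOrder σ → (D : Graph) → D ∈⟦ τ ⟧ G →
    Σ (LaconDecomposition D) λ Λ → (r : ℕ) →
    (col r (L Λ) (π Λ) ≤ factor (col c G σ) * col (c * r) G σ) ×
    (wcol r (L Λ) (π Λ) ≤ factor (col c G σ) * wcol (c * r) G σ)
  decompose G σ σ-inj D D∈ with inhabited? (size D)
  ... | inj₂ empty = trivial D empty , λ r → ≤-trans (vacuous _) z≤n , ≤-trans (vacuous _) z≤n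
    where
    vacuous : (g : Fin (size D + 0) → ℕ) → maxOver g ≤ 0
    vacuous g = maxOver-≤ g λ a → ⊥-elim (empty ([ (λ t → t) , (λ ()) ]′ (splitAt (size D) a)))
  ... | inj₁ t₀ = decomposition , λ r → col-bound r , wcol-bound r
    where
    M : ℕ
    M = listSize (col c G σ)
    short : ∀ w → length (Order.down G σ c c w) ≤ M
    short = Order.length-down G σ c c
    open Agreement τ G σ D D∈ M short using (v; codeOf; agree)
    open Bounds G σ σ-inj D (codes τ M) s M v t₀ short codeOf agree
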